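{- Consider the online AdCell problem with capacity constraints only. Let $\overline{OPT}_C$ be the optimal value of the linear program $\overline{LP}_C$. Then the expected revenue of Algorithm B (defined in the context) is at least $\frac12\,\overline{OPT}_C$. Consequently, the expected revenue of Algorithm B is also at least $\frac12$ of the expected revenue of the optimal offline allocation.
   Context: Problem. There are advertisers $i\in[m]$, queries $j\in[n]$, customers $k\in[s]$, and bids $u_{ij}\ge0$ of advertiser $i$ for query $j$. The queries are partitioned into sets $S_1,\dots,S_s$, where $S_k$ is the set of queries of customer $k$; customer $k$ has an integer capacity $c_k$. Each query $j$ has an arrival time and arrives with probability $p_j>0$; $I_j\in\{0,1\}$ is its arrival indicator. Arrivals of queries with different arrival times or from different customers are independent; queries of the same customer with the same arrival time are mutually exclusive (at most one of them arrives). All parameters are known in advance. Queries arrive online in order of arrival time and, upon arrival, each must immediately be allocated to one advertiser or discarded. An allocation is $X_{ij}\in\{0,1\}$ with $\sum_i X_{ij}\le I_j$ for all $j$ and $\sum_{j\in S_k}\sum_i X_{ij}\le c_k$ for all $k$; there are no budgets, and its revenue is $\sum_i\sum_j X_{ij}u_{ij}$. The optimal offline allocation is an allocation maximizing the revenue with full knowledge of the realized $I_1,\dots,I_n$. Linear program $\overline{LP}_C$: maximize $\sum_i\sum_j x_{ij}u_{ij}$ subject to $\sum_i x_{ij}\le p_j$ for all $j\in[n]$, $\sum_{j\in S_k}\sum_i x_{ij}\le c_k$ for all $k\in[s]$, and $x_{ij}\in[0,1]$. Algorithm B. Compute an optimal (possibly fractional) solution $x^*$ of $\overline{LP}_C$.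 Partition the queries into $T_1,\dots,T_u$ in increasing order of arrival time, all queries in one $T_t$ having the same arrival time. For $k\in[s]$, $t\in[u]$, $r\in[c_k]$ define recursively $$E_{k,t}^r=\sum_{j\in T_t\cap S_k}\sum_{i\in[m]}x^*_{ij}\max\left(u_{ij}+E_{k,t+1}^{r-1},\,E_{k,t+1}^{r}\right)+\Big(1-\sum_{j\in T_t\cap S_k}\sum_{i\in[m]}x^*_{ij}\Big)E_{k,t+1}^{r},$$ with $E_{k,t}^0=0$ and $E_{k,u+1}^r=0$. When query $j\in S_k\cap T_t$ arrives, choose one advertiser at random, advertiser $i$ being chosen with probability $x^*_{ij}/p_j$ (no advertiser is chosen, and the query is discarded, with the remaining probability), using fresh independent randomness for each query. Let $r$ be the current remaining capacity of customer $k$, i.e. $c_k$ minus the number of queries of customer $k$ allocated so far. If $r\ge1$ and $u_{ij}+E_{k,t+1}^{r-1}\ge E_{k,t+1}^{r}$, allocate query $j$ to advertiser $i$; otherwise discard it. -}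

module Defs where

open import Level using (Level; _⊔_) renaming (suc to lsuc)
open import Algebra.Bundles using (CommutativeRing; Semiring)
open import Algebra.Structures using (IsCommutativeRing)
import Algebra.Construct.NaturalChoice.Max as Max
import Algebra.Definitions.RawMonoid as RawMonoidDefs
import Algebra.Definitions.RawSemiring as RawSemiringDefs
import Algebra.Properties.Monoid.Sum as MonoidSum
open import Data.Bool.Base using (Bool; true; false; if_then_else_; _∧_)
open import Data.Bool.Properties using () renaming (_≟_ to _≟ᵇ_)
open import Data.Fin.Base using (Fin; zero; suc; inject₁; fromℕ)
open import Data.Fin.Properties using (_≟_)
open import Data.Fin.Subset using (Subset; _∩_)
open import Data.List.Base using (List; []; _∷_; map; concatMap; filter; allFin; foldr)
open import Data.List.Relation.Unary.All using (All)
open import Data.Maybe.Base using (Maybe; just; nothing)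
open import Data.Nat.Base as ℕ using (ℕ; zero; suc; _∸_)
open import Data.Product.Base using (∃; _×_; _,_; proj₁; proj₂; map₁)
open import Data.Vec.Base using (lookup; tabulate)
open import Data.Vec.Functional using (Vector; updateAt)
open import Data.Vec.Properties using (≡-dec)
open import Function.Base using (_∘_; const)
open import Relation.Binary.Bundles using (DecTotalOrder)
open import Relation.Binary.Core using (Rel)
open import Relation.Binary.Structures using (IsDecTotalOrder)
import Relation.Binary.Construct.NonStrictToStrict as ToStrict
open import Relation.Binary.PropositionalEquality.Core using (_≡_; _≢_; refl)
open import Relation.Nullary.Decidable.Core using (does)
open import Relation.Nullary.Negation.Core using (¬_)

-- Stand-in for the real numbers: ℝ is an instance classically, ℚ constructively.
-- The inverse is total, but nothing is assumed about the inverse of zero.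
record OrderedField (c ℓ₁ ℓ₂ : Level) : Set (lsuc (c ⊔ ℓ₁ ⊔ ℓ₂)) where
  infix  8 -_ _⁻¹
  infixl 7 _*_
  infixl 6 _+_
  infix  4 _≈_ _≤_
  field
    Carrier           : Set c
    _≈_               : Rel Carrier ℓ₁
    _≤_               : Rel Carrier ℓ₂
    _+_ _*_           : Carrier → Carrier → Carrier
    -_ _⁻¹            : Carrier → Carrier
    0# 1#             : Carrier
    isCommutativeRing : IsCommutativeRing _≈_ _+_ _*_ -_ 0# 1#
    isDecTotalOrder   : IsDecTotalOrder _≈_ _≤_
    1≉0               : ¬ 1# ≈ 0#
    ⁻¹-inverseʳ       : ∀ {x} → ¬ x ≈ 0# → x * x ⁻¹ ≈ 1#
    +-monoˡ-≤         : ∀ {x y} z → x ≤ y → x + z ≤ y + z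
    *-nonNeg          : ∀ {x y} → 0# ≤ x → 0# ≤ y → 0# ≤ x * y

  commutativeRing : CommutativeRing c ℓ₁
  commutativeRing = record { isCommutativeRing = isCommutativeRing }

  decTotalOrder : DecTotalOrder c ℓ₁ ℓ₂
  decTotalOrder = record { isDecTotalOrder = isDecTotalOrder }

  open CommutativeRing commutativeRing public
    using (_-_; semiring; +-monoid)
  open DecTotalOrder decTotalOrder public using (_≤?_; totalOrder)
  open ToStrict _≈_ _≤_ public using (_<_)
  open Max totalOrder public using () renaming (_⊔_ to max)
  open MonoidSum +-monoid public using (sum; sum-syntax)
  open RawSemiringDefs (Semiring.rawSemiring semiring) public
    using (product) renaming (_×_ to _·_)

  infixl 7 _/_
  _/_ : Carrier → Carrier → Carrier
  x / y = x * y ⁻¹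

  ½ : Carrier
  ½ = 1# / (1# + 1#)

  infixl 10 sumOver
  sumOver : ∀ {n} → Subset n → Vector Carrier n → Carrier
  sumOver A f = sum (λ j → if lookup A j then f j else 0#)

  syntax sumOver A (λ j → e) = ∑[ j ∈ A ] e

sumℕ : ∀ {n} → Vector ℕ n → ℕ
sumℕ = RawMonoidDefs.sum ℕ.+-0-rawMonoid

toℕ : Bool → ℕ
toℕ b = if b then 1 else 0

module Probability {c ℓ₁ ℓ₂} (F : OrderedField c ℓ₁ ℓ₂) where
  open OrderedField F

  -- Finite lists of weighted outcomes; the same outcome may occur repeatedly.
  Dist : Set → Set c
  Dist A = List (Carrier × A)

  𝔼 : ∀ {A} → Dist A → (A → Carrier) → Carrier
  𝔼 d f = foldr (λ (w , a) acc → w * f a + acc) 0# d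

  ℙ : ∀ {A} → Dist A → (A → Bool) → Carrier
  ℙ d event = 𝔼 d (λ a → if event a then 1# else 0#)

  record IsProbability {A} (d : Dist A) : Set (c ⊔ ℓ₁ ⊔ ℓ₂) where
    field
      nonNeg : All (λ (w , _) → 0# ≤ w) d
      total  : 𝔼 d (const 1#) ≈ 1#

  pure : ∀ {A} → A → Dist A
  pure a = (1# , a) ∷ []

  infixl 1 _>>=_
  _>>=_ : ∀ {A B} → Dist A → (A → Dist B) → Dist B
  d >>= f = concatMap (λ (w , a) → map (map₁ (w *_)) (f a)) d

-- m advertisers, n queries, s customers.  Only the order of the arrival times
-- matters, so the arrival time of a query is recorded as the index t of the
-- part T t it belongs to.
record AdCell {c ℓ₁ ℓ₂} (F : OrderedField c ℓ₁ ℓ₂) (m n s u : ℕ) : Set (c ⊔ ℓ₁ ⊔ ℓ₂) where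
  open OrderedField F
  open Probability F
  field
    bid      : Fin m → Fin n → Carrier
    bid≥0    : ∀ i j → 0# ≤ bid i j
    customer : Fin n → Fin s
    capacity : Fin s → ℕ
    arrival  : Fin n → Fin u
    p        : Fin n → Carrier
    p>0      : ∀ j → 0# < p j

  S : Fin s → Subset n
  S k = tabulate (λ j → does (customer j ≟ k))

  T : Fin u → Subset n
  T t = tabulate (λ j → does (arrival j ≟ t))

  -- `arrivals` is the joint law of (I_1, …, I_n), an outcome ω being the set of
  -- queries that arrive.  The arrival vectors of the blocks T t ∩ S k are
  -- mutually independent: the joint mass function is the product of theirs.
  field
    arrivals      : Dist (Subset n)
    isProbability : IsProbability arrivals
    marginal      : ∀ j → ℙ arrivals (λ ω → lookup ω j) ≈ p j
    exclusive     : ∀ j j′ → j ≢ j′ → customer j ≡ customer j′ → arrival j ≡ arrival j′ →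
                    ℙ arrivals (λ ω → lookup ω j ∧ lookup ω j′) ≈ 0#
    independent   : ∀ (a : Subset n) →
                    ℙ arrivals (λ ω → does (≡-dec _≟ᵇ_ ω a)) ≈
                    product (λ k → product (λ t →
                      ℙ arrivals (λ ω → does (≡-dec _≟ᵇ_ (T t ∩ S k ∩ ω) (T t ∩ S k ∩ a)))))

module LinearProgram {c ℓ₁ ℓ₂} {F : OrderedField c ℓ₁ ℓ₂} {m n s u} (P : AdCell F m n s u) where
  open OrderedField F
  open AdCell P

  objective : (Fin m → Fin n → Carrier) → Carrier
  objective x = ∑[ i < m ] ∑[ j < n ] (x i j * bid i j)

  record IsFeasible (x : Fin m → Fin n → Carrier) : Set ℓ₂ where
    field
      query≤    : ∀ j → ∑[ i < m ] x i j ≤ p j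
      customer≤ : ∀ k → ∑[ j ∈ S k ] ∑[ i < m ] x i j ≤ capacity k · 1#
      x≥0       : ∀ i j → 0# ≤ x i j
      x≤1       : ∀ i j → x i j ≤ 1#

  IsOptimalSolution : (Fin m → Fin n → Carrier) → Set (c ⊔ ℓ₂)
  IsOptimalSolution x = IsFeasible x × (∀ y → IsFeasible y → objective y ≤ objective x)

  IsOptimalValue : Carrier → Set (c ⊔ ℓ₁ ⊔ ℓ₂)
  IsOptimalValue v = ∃ λ x → IsOptimalSolution x × v ≈ objective x

module Allocations {c ℓ₁ ℓ₂} {F : OrderedField c ℓ₁ ℓ₂} {m n s u} (P : AdCell F m n s u) where
  open OrderedField F
  open Probability F
  open AdCell P

  Allocation : Set
  Allocation = Fin m → Fin n → Bool

  revenue : Allocation → Carrier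
  revenue X = ∑[ i < m ] ∑[ j < n ] (if X i j then bid i j else 0#)

  used : Allocation → Fin s → ℕ
  used X k = sumℕ (λ j → if lookup (S k) j then sumℕ (λ i → toℕ (X i j)) else 0)

  record IsAllocation (ω : Subset n) (X : Allocation) : Set where
    field
      query≤    : ∀ j → sumℕ (λ i → toℕ (X i j)) ℕ.≤ toℕ (lookup ω j)
      customer≤ : ∀ k → used X k ℕ.≤ capacity k

  IsOptimalOffline : (Subset n → Allocation) → Set ℓ₂
  IsOptimalOffline opt = ∀ ω → IsAllocation ω (opt ω) ×
                               (∀ Y → IsAllocation ω Y → revenue Y ≤ revenue (opt ω))

  expectedOfflineRevenue : (Subset n → Allocation) → Carrier
  expectedOfflineRevenue opt = 𝔼 arrivals (revenue ∘ opt)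

backward : ∀ {a} {A : Set a} u → (Fin u → A → A) → A → Fin (suc u) → A
backward zero    f e zero    = e
backward (suc u) f e zero    = f zero (backward u (f ∘ suc) e zero)
backward (suc u) f e (suc t) = backward u (f ∘ suc) e t

backward-last : ∀ {a} {A : Set a} u (f : Fin u → A → A) (e : A) →
                backward u f e (fromℕ u) ≡ e
backward-last zero    f e = refl
backward-last (suc u) f e = backward-last u (f ∘ suc) e

backward-step : ∀ {a} {A : Set a} u (f : Fin u → A → A) (e : A) (t : Fin u) →
                backward u f e (inject₁ t) ≡ f t (backward u f e (suc t))
backward-step (suc u) f e zero    = refl
backward-step (suc u) f e (suc t) = backward-step u (f ∘ suc) e t

module AlgorithmB {c ℓ₁ ℓ₂} {F : OrderedField c ℓ₁ ℓ₂} {m n s u} (P : AdCell F m n s u)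
                  (x : Fin m → Fin n → OrderedField.Carrier F) where
  open OrderedField F
  open Probability F
  open AdCell P
  open Allocations P

  stage : Fin s → Fin u → (ℕ → Carrier) → (ℕ → Carrier)
  stage k t V zero    = 0#
  stage k t V (suc r) =
      ∑[ j ∈ T t ∩ S k ] ∑[ i < m ] (x i j * max (bid i j + V r) (V (suc r)))
    + (1# - ∑[ j ∈ T t ∩ S k ] ∑[ i < m ] x i j) * V (suc r)

  -- E k (inject₁ t) r and E k (suc t) r are the values at stages t and t + 1;
  -- backward-last and backward-step are the defining equations.
  E : Fin s → Fin (suc u) → ℕ → Carrier
  E k = backward u (stage k) (const 0#)

  choose : Fin n → Dist (Maybe (Fin m))
  choose j = (1# - ∑[ i < m ] (x i j / p j) , nothing)
           ∷ map (λ i → x i j / p j , just i) (allFin m)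

  allocate : Fin m → Fin n → Allocation → Allocation
  allocate i j X = updateAt X i (λ row → updateAt row j (const true))

  -- The last argument is the remaining capacity of the customer of query j.
  accepts : Fin m → Fin n → ℕ → Bool
  accepts i j zero    = false
  accepts i j (suc r) =
    does (E (customer j) (suc (arrival j)) (suc r) ≤?
          bid i j + E (customer j) (suc (arrival j)) r)

  decide : Fin n → Maybe (Fin m) → Allocation → Allocation
  decide j nothing  X = X
  decide j (just i) X =
    if accepts i j (capacity (customer j) ∸ used X (customer j)) then allocate i j X else X

  process : Subset n → Fin n → Allocation → Dist Allocation
  process ω j X =
    if lookup ω j
    then (choose j >>= λ choice → pure (decide j choice X))
    else pure X

  run : Subset n → List (Fin n) → Allocation → Dist Allocation
  run ω []       X = pure X
  run ω (j ∷ js) X = process ω j X >>= run ω js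

  -- Increasing arrival time; simultaneous queries are taken in index order.
  order : List (Fin n)
  order = concatMap (λ t → filter (λ j → arrival j ≟ t) (allFin n)) (allFin u)

  expectedRevenue : Carrier
  expectedRevenue = 𝔼 (arrivals >>= λ ω → run ω order (λ _ _ → false)) revenue

{-# OPTIONS --safe #-}

-- Customers do not interact, so fix one.  Given an arrival set, its expected revenue is a
-- telescoping sum of increments, one per arriving query; taking expectations block by block
-- and using that the block T t is independent of the later blocks shows that Algorithm B
-- earns exactly the dynamic-programming value E k zero (capacity k).
--
-- For a price τ ≥ 0 let w be the sum of x i j * max (bid i j - τ) 0 over the remaining
-- queries.  By backward induction the dynamic program with remaining capacity r is worth at
-- least min (r · τ) w.  With O the contribution of the customer to the linear program and
-- capacity · τ = ½ * O, feasibility of x gives O ≤ w + capacity · τ for the initial w, so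
-- both arguments of the minimum are at least ½ * O.
--
-- The probabilities with which the offline optimum allocates j to i are a feasible solution
-- of the linear program, which yields the comparison with the offline optimum.

module Submission where

open import Defs
open import Algebra.Bundles using (CommutativeMonoid; CommutativeRing)
import Algebra.Construct.NaturalChoice.Max as Max
import Algebra.Construct.NaturalChoice.Min as Min
import Algebra.Properties.AbelianGroup as AbelianGroupProperties
import Algebra.Properties.CommutativeMonoid.Sum as CommutativeMonoidSum
import Algebra.Properties.CommutativeSemigroup as CommutativeSemigroupProperties
import Algebra.Properties.Ring as RingProperties
import Algebra.Properties.Semiring.Mult as SemiringMult
import Algebra.Properties.Semiring.Sum as SemiringSum
open import Data.Bool.Base using (Bool; true; false; if_then_else_; _∧_)
open import Data.Bool.Properties using (¬-not; ∧-zeroʳ; ∧-identityʳ) renaming (_≟_ to _≟ᵇ_)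
open import Data.Empty using (⊥-elim)
open import Data.Fin.Base using (Fin; zero; suc)
open import Data.Fin.Properties using (_≟_; suc-injective; 0≢1+n)
open import Data.Fin.Subset using (Subset; _∩_)
open import Data.List.Base using (List; []; _∷_; _++_; map; concatMap; filter; allFin; foldr; tabulate)
open import Data.List.Membership.Propositional using (_∈_)
open import Data.List.Relation.Binary.Disjoint.Propositional using (Disjoint)
open import Data.List.Relation.Unary.All as All using (All; []; _∷_)
import Data.List.Relation.Unary.All.Properties as Allₚ
open import Data.List.Relation.Unary.AllPairs as AllPairs using ([]; _∷_)
import Data.List.Relation.Unary.AllPairs.Properties as AllPairsₚ
open import Data.List.Relation.Unary.Unique.Propositional using (Unique)
import Data.List.Relation.Unary.Unique.Propositional.Properties as Uniqueₚ
open import Data.Maybe.Base using (Maybe; just; nothing)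
open import Data.Nat.Base as ℕ using (ℕ; zero; suc; _∸_)
import Data.Nat.Properties as ℕₚ
open import Data.Product.Base using (_×_; _,_; proj₁; proj₂; map₁)
open import Data.Sum.Base using (_⊎_; inj₁; inj₂)
open import Data.Vec.Base using ([]; _∷_; lookup)
open import Data.Vec.Functional using (Vector; updateAt)
open import Data.Vec.Functional.Properties using (updateAt-updates; updateAt-minimal)
open import Data.Vec.Properties using (≡-dec; lookup-zipWith; lookup∘tabulate; tabulate∘lookup; tabulate-cong)
open import Function.Base using (_∘_; const; id)
open import Level using (Level)
open import Relation.Binary.Bundles using (DecTotalOrder)
open import Relation.Binary.PropositionalEquality as ≡ using (_≡_; _≢_)
import Relation.Binary.Reasoning.PartialOrder as PartialOrderReasoning
import Relation.Binary.Reasoning.Setoid as SetoidReasoning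
open import Relation.Nullary.Decidable.Core using (does; yes; no)
open import Relation.Nullary.Negation.Core using (¬_)
open import Relation.Unary using (Pred; Decidable)

-- Changing one term of a finite sum.

module SumUpdate {a ℓ} (M : CommutativeMonoid a ℓ) where
  open CommutativeMonoid M
  open CommutativeMonoidSum M
  open CommutativeSemigroupProperties commutativeSemigroup using (xy∙z≈xz∙y)

  -- Stated for an arbitrary commutative monoid because it serves both revenues in the field and
  -- counts in `ℕ`.
  sum-update : ∀ {n} (i : Fin n) (f g : Vector Carrier n) d →
               (∀ j → j ≢ i → g j ≈ f j) → g i ≈ f i ∙ d → sum g ≈ sum f ∙ d
  sum-update zero    f g d same upd =
    trans (∙-cong upd (sum-cong-≋ (λ j → same (suc j) λ ()))) (xy∙z≈xz∙y _ _ _)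
  sum-update (suc i) f g d same upd =
    trans (∙-cong (same zero λ ())
                  (sum-update i (f ∘ suc) (g ∘ suc) d (λ j j≢i → same (suc j) (j≢i ∘ suc-injective)) upd))
          (sym (assoc _ _ _))

-- Arithmetic, order and finite sums in an ordered field.

module OrderedFieldProperties {c ℓ₁ ℓ₂} (F : OrderedField c ℓ₁ ℓ₂) where
  open OrderedField F public
  open CommutativeRing commutativeRing public
    using ( refl; sym; trans; reflexive; setoid; +-cong; +-congˡ; +-congʳ; *-cong; *-congˡ; *-congʳ
          ; +-identityˡ; +-identityʳ; +-assoc; +-comm; *-identityˡ; *-identityʳ; *-assoc; *-comm
          ; distribˡ; distribʳ; zeroˡ; zeroʳ; -‿cong; -‿inverseʳ
          ; +-commutativeMonoid; *-commutativeMonoid; +-abelianGroup; ring )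
  open DecTotalOrder decTotalOrder public
    using (poset; antisym; total)
    renaming (refl to ≤-refl; reflexive to ≤-reflexive; trans to ≤-trans; _≟_ to _≈?_)
  open SemiringSum semiring public
    using (sum-cong-≋; ∑-distrib-+; ∑-comm; *-distribˡ-sum; *-distribʳ-sum; sum-replicate-zero)
  open SemiringMult semiring public using (×-congʳ; ×-homo-+; ×-comm-*)
  open SumUpdate +-commutativeMonoid public using (sum-update)
  open AbelianGroupProperties +-abelianGroup public
    using (⁻¹-∙-comm; xyx⁻¹≈y; ε⁻¹≈ε)
  open RingProperties ring public using (-‿distribˡ-*; -‿distribʳ-*)
  open CommutativeSemigroupProperties (CommutativeMonoid.commutativeSemigroup +-commutativeMonoid) public
    using () renaming (interchange to +-interchange)
  open CommutativeSemigroupProperties (CommutativeMonoid.commutativeSemigroup *-commutativeMonoid) public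
    using () renaming (interchange to *-interchange; x∙yz≈y∙xz to *-swapˡ)
  open Max totalOrder public using ()
    renaming (x≤y⇒x⊔y≈y to x≤y⇒max≈y; x≤y⇒y⊔x≈y to y≤x⇒max≈x; x≤x⊔y to x≤max; x≤y⊔x to y≤max)
  open Min totalOrder public using ()
    renaming (_⊓_ to min; x⊓y≤x to min≤x; x⊓y≤y to min≤y; ⊓-glb to min-glb; ⊓-sel to min-sel)

  module ≈-Reasoning = SetoidReasoning setoid
  module ≤-Reasoning = PartialOrderReasoning poset

  x+[y-x]≈y : ∀ x y → x + (y - x) ≈ y
  x+[y-x]≈y x y = trans (sym (+-assoc x y (- x))) (xyx⁻¹≈y x y)

  [1-a]x+ax≈x : ∀ a x → (1# - a) * x + a * x ≈ x
  [1-a]x+ax≈x a x = begin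
    (1# - a) * x + a * x    ≈⟨ distribʳ x (1# - a) a ⟨
    (1# - a + a) * x        ≈⟨ *-congʳ (trans (+-comm _ a) (x+[y-x]≈y a 1#)) ⟩
    1# * x                  ≈⟨ *-identityˡ x ⟩
    x                       ∎
    where open ≈-Reasoning

  +-mono-≤ : ∀ {w x y z} → w ≤ x → y ≤ z → w + y ≤ x + z
  +-mono-≤ {w} {x} {y} {z} w≤x y≤z = begin
    w + y  ≤⟨ +-monoˡ-≤ y w≤x ⟩
    x + y  ≈⟨ +-comm x y ⟩
    y + x  ≤⟨ +-monoˡ-≤ x y≤z ⟩
    z + x  ≈⟨ +-comm z x ⟩
    x + z  ∎
    where open ≤-Reasoning

  x≤y⇒0≤y-x : ∀ {x y} → x ≤ y → 0# ≤ y - x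
  x≤y⇒0≤y-x {x} {y} x≤y = begin
    0#     ≈⟨ -‿inverseʳ x ⟨
    x - x  ≤⟨ +-monoˡ-≤ (- x) x≤y ⟩
    y - x  ∎
    where open ≤-Reasoning

  0≤y-x⇒x≤y : ∀ {x y} → 0# ≤ y - x → x ≤ y
  0≤y-x⇒x≤y {x} {y} 0≤y-x = begin
    x            ≈⟨ +-identityʳ x ⟨
    x + 0#       ≤⟨ +-mono-≤ ≤-refl 0≤y-x ⟩
    x + (y - x)  ≈⟨ x+[y-x]≈y x y ⟩
    y            ∎
    where open ≤-Reasoning

  +-cancelʳ-≤ : ∀ z {x y} → x + z ≤ y + z → x ≤ y
  +-cancelʳ-≤ z {x} {y} le = begin
    x              ≈⟨ cancel x ⟨
    x + z + - z    ≤⟨ +-monoˡ-≤ (- z) le ⟩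
    y + z + - z    ≈⟨ cancel y ⟩
    y              ∎
    where
    open ≤-Reasoning
    cancel : ∀ w → w + z + - z ≈ w
    cancel w = trans (+-assoc w z (- z)) (trans (+-congˡ (-‿inverseʳ z)) (+-identityʳ w))

  *-monoˡ-≤ : ∀ {z x y} → 0# ≤ z → x ≤ y → z * x ≤ z * y
  *-monoˡ-≤ {z} {x} {y} 0≤z x≤y = 0≤y-x⇒x≤y (begin
    0#                ≤⟨ *-nonNeg 0≤z (x≤y⇒0≤y-x x≤y) ⟩
    z * (y - x)       ≈⟨ distribˡ z y (- x) ⟩
    z * y + z * - x   ≈⟨ +-congˡ (-‿distribʳ-* z x) ⟨
    z * y - z * x     ∎)
    where open ≤-Reasoning

  0≤1 : 0# ≤ 1#
  0≤1 with total 0# 1#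
  ... | inj₁ 0≤1 = 0≤1
  -- If `1#` were at most `0#`, then `- 1#` would be nonnegative, and `1#` is its square.
  ... | inj₂ 1≤0 = begin
    0#             ≤⟨ *-nonNeg 0≤-1 0≤-1 ⟩
    - 1# * - 1#    ≈⟨ -‿distribˡ-* 1# (- 1#) ⟨
    - (1# * - 1#)  ≈⟨ -‿cong (-‿distribʳ-* 1# 1#) ⟨
    - - (1# * 1#)  ≈⟨ AbelianGroupProperties.⁻¹-involutive +-abelianGroup _ ⟩
    1# * 1#        ≈⟨ *-identityˡ 1# ⟩
    1#             ∎
    where
    open ≤-Reasoning
    0≤-1 : 0# ≤ - 1#
    0≤-1 = ≤-trans (x≤y⇒0≤y-x 1≤0) (≤-reflexive (+-identityˡ (- 1#)))

  sum-mono-≤ : ∀ {n} {f g : Vector Carrier n} → (∀ i → f i ≤ g i) → sum f ≤ sum g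
  sum-mono-≤ {zero}  f≤g = ≤-refl
  sum-mono-≤ {suc n} f≤g = +-mono-≤ (f≤g zero) (sum-mono-≤ (f≤g ∘ suc))

  sum-zero : ∀ {n} {f : Vector Carrier n} → (∀ i → f i ≈ 0#) → sum f ≈ 0#
  sum-zero {n} f≈0 = trans (sum-cong-≋ f≈0) (sum-replicate-zero n)

  sum-nonNeg : ∀ {n} {f : Vector Carrier n} → (∀ i → 0# ≤ f i) → 0# ≤ sum f
  sum-nonNeg {n} 0≤f = ≤-trans (≤-reflexive (sym (sum-replicate-zero n))) (sum-mono-≤ 0≤f)

  term≤sum : ∀ {n} (f : Vector Carrier n) → (∀ i → 0# ≤ f i) → ∀ i → f i ≤ sum f
  term≤sum f 0≤f zero    = ≤-trans (≤-reflexive (sym (+-identityʳ _))) (+-mono-≤ ≤-refl (sum-nonNeg (0≤f ∘ suc)))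
  term≤sum f 0≤f (suc i) = ≤-trans (term≤sum (f ∘ suc) (0≤f ∘ suc) i)
    (≤-trans (≤-reflexive (sym (+-identityˡ _))) (+-mono-≤ (0≤f zero) ≤-refl))

  sum-single : ∀ {n} (i : Fin n) x → ∑[ j < n ] (if does (i ≟ j) then x else 0#) ≈ x
  sum-single {n} i x = begin
    ∑[ j < n ] (if does (i ≟ j) then x else 0#)  ≈⟨ sum-update i (const 0#) _ x other at-i ⟩
    ∑[ j < n ] 0# + x                            ≈⟨ +-congʳ (sum-replicate-zero n) ⟩
    0# + x                                       ≈⟨ +-identityˡ x ⟩
    x                                            ∎
    where
    open ≈-Reasoning
    other : ∀ j → j ≢ i → (if does (i ≟ j) then x else 0#) ≈ 0#
    other j j≢i with i ≟ j
    ... | yes ≡.refl = ⊥-elim (j≢i ≡.refl)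
    ... | no _       = refl
    at-i : (if does (i ≟ i) then x else 0#) ≈ 0# + x
    at-i with i ≟ i
    ... | yes _  = sym (+-identityˡ x)
    ... | no i≢i = ⊥-elim (i≢i ≡.refl)

  if-cong : ∀ b {x y z : Carrier} → x ≈ y → (if b then x else z) ≈ (if b then y else z)
  if-cong true  x≈y = x≈y
  if-cong false x≈y = refl

  sumOver-cong : ∀ {n} (A : Subset n) {f g : Vector Carrier n} → (∀ j → f j ≈ g j) → sumOver A f ≈ sumOver A g
  sumOver-cong A f≈g = sum-cong-≋ (λ j → if-cong (lookup A j) (f≈g j))

  sumOver-mono-≤ : ∀ {n} (A : Subset n) {f g : Vector Carrier n} → (∀ j → f j ≤ g j) → sumOver A f ≤ sumOver A g
  sumOver-mono-≤ A {f} {g} f≤g = sum-mono-≤ λ j → go j (lookup A j)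
    where
    go : ∀ j b → (if b then f j else 0#) ≤ (if b then g j else 0#)
    go j true  = f≤g j
    go j false = ≤-refl

  sumOver-distrib-+ : ∀ {n} (A : Subset n) (f g : Vector Carrier n) →
                      ∑[ j ∈ A ] (f j + g j) ≈ sumOver A f + sumOver A g
  sumOver-distrib-+ {n} A f g = trans (sum-cong-≋ λ j → go j (lookup A j)) (∑-distrib-+ {n} _ _)
    where
    go : ∀ j b → (if b then f j + g j else 0#) ≈ (if b then f j else 0#) + (if b then g j else 0#)
    go j true  = refl
    go j false = sym (+-identityˡ 0#)

  sumOver-distribʳ-* : ∀ {n} (A : Subset n) (f : Vector Carrier n) z →
                       ∑[ j ∈ A ] (f j * z) ≈ sumOver A f * z
  sumOver-distribʳ-* {n} A f z = trans (sum-cong-≋ λ j → go j (lookup A j)) (sym (*-distribʳ-sum {n} z _))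
    where
    go : ∀ j b → (if b then f j * z else 0#) ≈ (if b then f j else 0#) * z
    go j true  = refl
    go j false = sym (zeroˡ z)

  listSum : ∀ {A : Set} → (A → Carrier) → List A → Carrier
  listSum f = foldr (λ a acc → f a + acc) 0#

  listSum-filter : ∀ {A : Set} {p} {Q : Pred A p} (Q? : Decidable Q) (f : A → Carrier) {n} (g : Fin n → A) →
                   listSum f (filter Q? (tabulate g)) ≈ ∑[ i < n ] (if does (Q? (g i)) then f (g i) else 0#)
  listSum-filter Q? f {zero}  g = refl
  listSum-filter Q? f {suc n} g with does (Q? (g zero))
  ... | true  = +-congˡ (listSum-filter Q? f (g ∘ suc))
  ... | false = trans (listSum-filter Q? f (g ∘ suc)) (sym (+-identityˡ _))

  sumOver-zero : ∀ {n} (A : Subset n) {f : Vector Carrier n} → (∀ j → f j ≈ 0#) → sumOver A f ≈ 0#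
  sumOver-zero A {f} f≈0 = sum-zero λ j → go j (lookup A j)
    where
    go : ∀ j b → (if b then f j else 0#) ≈ 0#
    go j true  = f≈0 j
    go j false = refl

  sumOver-nonNeg : ∀ {n} (A : Subset n) {f : Vector Carrier n} → (∀ j → 0# ≤ f j) → 0# ≤ sumOver A f
  sumOver-nonNeg A 0≤f = ≤-trans (≤-reflexive (sym (sumOver-zero A (λ _ → refl)))) (sumOver-mono-≤ A 0≤f)

  -- Each `j` lies in the single fibre over `h j`. Applied to the partition of the queries by
  -- customer and to that by arrival time.
  ∑-fibres : ∀ {n s} (h : Fin n → Fin s) (f : Vector Carrier n) →
             ∑[ k < s ] ∑[ j < n ] (if does (h j ≟ k) then f j else 0#) ≈ ∑[ j < n ] f j
  ∑-fibres h f = trans (∑-comm (λ k j → if does (h j ≟ k) then f j else 0#)) (sum-cong-≋ λ j → sum-single (h j) (f j))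

  sumℕ-homo : ∀ {n} (f : Vector ℕ n) x → sumℕ f · x ≈ ∑[ i < n ] (f i · x)
  sumℕ-homo {zero}  f x = refl
  sumℕ-homo {suc n} f x = trans (×-homo-+ x (f zero) _) (+-congˡ (sumℕ-homo (f ∘ suc) x))

  ·1-mono-≤ : ∀ {m n} → m ℕ.≤ n → m · 1# ≤ n · 1#
  ·1-mono-≤ {n = zero}  ℕ.z≤n       = ≤-refl
  ·1-mono-≤ {n = suc n} ℕ.z≤n       =
    ≤-trans (≤-reflexive (sym (+-identityˡ 0#))) (+-mono-≤ 0≤1 (·1-mono-≤ {n = n} ℕ.z≤n))
  ·1-mono-≤ (ℕ.s≤s m≤n) = +-mono-≤ ≤-refl (·1-mono-≤ m≤n)

  1≤suc·1 : ∀ n → 1# ≤ suc n · 1#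
  1≤suc·1 n = ≤-trans (≤-reflexive (sym (+-identityʳ 1#))) (·1-mono-≤ {1} {suc n} (ℕ.s≤s ℕ.z≤n))

  1≤x⇒x≉0 : ∀ {x} → 1# ≤ x → ¬ x ≈ 0#
  1≤x⇒x≉0 1≤x x≈0 = 1≉0 (antisym (≤-trans 1≤x (≤-reflexive x≈0)) 0≤1)

  -- Supplies the sign of inverses: with `y ≤ 0#` the product would be at most `0#`, yet it is `1#`.
  x*y≈1⇒0≤y : ∀ {x y} → 0# ≤ x → x * y ≈ 1# → 0# ≤ y
  x*y≈1⇒0≤y {x} {y} 0≤x xy≈1 with total 0# y
  ... | inj₁ 0≤y = 0≤y
  ... | inj₂ y≤0 = ⊥-elim (1≉0 (antisym (begin
    1#      ≈⟨ xy≈1 ⟨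
    x * y   ≤⟨ *-monoˡ-≤ 0≤x y≤0 ⟩
    x * 0#  ≈⟨ zeroʳ x ⟩
    0#      ∎) 0≤1))
    where open ≤-Reasoning

  1≤2 : 1# ≤ 1# + 1#
  1≤2 = ≤-trans (≤-reflexive (sym (+-identityʳ 1#))) (+-mono-≤ ≤-refl 0≤1)

  2*½≈1 : (1# + 1#) * ½ ≈ 1#
  2*½≈1 = trans (*-congˡ (*-identityˡ _)) (⁻¹-inverseʳ (1≤x⇒x≉0 1≤2))

  0≤½ : 0# ≤ ½
  0≤½ = x*y≈1⇒0≤y (≤-trans 0≤1 1≤2) 2*½≈1

  ½x+½x≈x : ∀ x → ½ * x + ½ * x ≈ x
  ½x+½x≈x x = begin
    ½ * x + ½ * x              ≈⟨ distribʳ x ½ ½ ⟨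
    (½ + ½) * x                ≈⟨ *-congʳ (+-cong (*-identityˡ ½) (*-identityˡ ½)) ⟨
    (1# * ½ + 1# * ½) * x      ≈⟨ *-congʳ (distribʳ ½ 1# 1#) ⟨
    ((1# + 1#) * ½) * x        ≈⟨ *-congʳ 2*½≈1 ⟩
    1# * x                     ≈⟨ *-identityˡ x ⟩
    x                          ∎
    where open ≈-Reasoning

-- Expectations over finite weighted lists, and independence.

module Expectation {c ℓ₁ ℓ₂} (F : OrderedField c ℓ₁ ℓ₂) where
  open OrderedFieldProperties F
  open Probability F public

  𝟙 : Bool → Carrier
  𝟙 b = if b then 1# else 0#

  0≤𝟙 : ∀ b → 0# ≤ 𝟙 b
  0≤𝟙 true  = 0≤1
  0≤𝟙 false = ≤-refl

  𝟙*x≈if : ∀ b x → 𝟙 b * x ≈ (if b then x else 0#)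
  𝟙*x≈if true  x = *-identityˡ x
  𝟙*x≈if false x = zeroˡ x

  -- A true entry forces all later entries to be false, so at most one term of the sum is nonzero.
  count≤1 : ∀ {n} (b : Fin n → Bool) → (∀ i j → i ≢ j → b i ∧ b j ≡ false) → ∑[ j < n ] 𝟙 (b j) ≤ 1#
  count≤1 {zero}  b excl = 0≤1
  count≤1 {suc n} b excl with b zero in eq
  ... | true  = ≤-reflexive (trans (+-congˡ (sum-zero λ j → reflexive (≡.cong 𝟙 (others j)))) (+-identityʳ 1#))
    where
    others : ∀ j → b (suc j) ≡ false
    others j = ≡.trans (≡.cong (_∧ b (suc j)) (≡.sym eq)) (excl zero (suc j) λ ())
  ... | false = ≤-trans (≤-reflexive (+-identityˡ _))
                        (count≤1 (b ∘ suc) (λ i j i≢j → excl (suc i) (suc j) (i≢j ∘ suc-injective)))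

  private variable
    A B : Set

  -- The weight is part of the hypothesis, so the values may differ at outcomes of weight zero. This
  -- is how properties that hold only almost surely enter later.
  𝔼-cong-All : ∀ {d : Dist A} {f g} → All (λ (w , a) → w * f a ≈ w * g a) d → 𝔼 d f ≈ 𝔼 d g
  𝔼-cong-All []         = refl
  𝔼-cong-All (eq ∷ eqs) = +-cong eq (𝔼-cong-All eqs)

  𝔼-cong : ∀ (d : Dist A) {f g} → (∀ a → f a ≈ g a) → 𝔼 d f ≈ 𝔼 d g
  𝔼-cong d f≈g = 𝔼-cong-All {d = d} (All.universal (λ (w , a) → *-congˡ (f≈g a)) d)

  𝔼-mono-≤-All : ∀ {d : Dist A} {f g} → All (λ (w , a) → w * f a ≤ w * g a) d → 𝔼 d f ≤ 𝔼 d g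
  𝔼-mono-≤-All []         = ≤-refl
  𝔼-mono-≤-All (le ∷ les) = +-mono-≤ le (𝔼-mono-≤-All les)

  𝔼-0 : ∀ (d : Dist A) → 𝔼 d (const 0#) ≈ 0#
  𝔼-0 []      = refl
  𝔼-0 (_ ∷ d) = trans (+-cong (zeroʳ _) (𝔼-0 d)) (+-identityˡ 0#)

  𝔼-+ : ∀ (d : Dist A) f g → 𝔼 d (λ a → f a + g a) ≈ 𝔼 d f + 𝔼 d g
  𝔼-+ []            f g = sym (+-identityˡ 0#)
  𝔼-+ ((w , a) ∷ d) f g = trans (+-cong (distribˡ w (f a) (g a)) (𝔼-+ d f g)) (+-interchange _ _ _ _)

  𝔼-neg : ∀ (d : Dist A) f → 𝔼 d (λ a → - f a) ≈ - 𝔼 d f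
  𝔼-neg []            f = sym ε⁻¹≈ε
  𝔼-neg ((w , a) ∷ d) f =
    trans (+-cong (sym (-‿distribʳ-* w (f a))) (𝔼-neg d f)) (⁻¹-∙-comm _ _)

  𝔼-*ˡ : ∀ (d : Dist A) x f → 𝔼 d (λ a → x * f a) ≈ x * 𝔼 d f
  𝔼-*ˡ []            x f = sym (zeroʳ x)
  𝔼-*ˡ ((w , a) ∷ d) x f =
    trans (+-cong (*-swapˡ w x (f a)) (𝔼-*ˡ d x f)) (sym (distribˡ x _ _))

  𝔼-*ʳ : ∀ (d : Dist A) x f → 𝔼 d (λ a → f a * x) ≈ 𝔼 d f * x
  𝔼-*ʳ d x f = trans (𝔼-cong d (λ a → *-comm (f a) x)) (trans (𝔼-*ˡ d x f) (*-comm x _))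

  𝔼-if : ∀ (d : Dist A) b f → 𝔼 d (λ a → if b then f a else 0#) ≈ (if b then 𝔼 d f else 0#)
  𝔼-if d true  f = refl
  𝔼-if d false f = 𝔼-0 d

  𝔼-∑ : ∀ (d : Dist A) {n} (f : Fin n → A → Carrier) → 𝔼 d (λ a → ∑[ i < n ] f i a) ≈ ∑[ i < n ] 𝔼 d (f i)
  𝔼-∑ d {zero}  f = 𝔼-0 d
  𝔼-∑ d {suc n} f = trans (𝔼-+ d (f zero) _) (+-congˡ (𝔼-∑ d (f ∘ suc)))

  𝔼-sumOver : ∀ (d : Dist A) {n} (T : Subset n) (f : Fin n → A → Carrier) →
              𝔼 d (λ a → ∑[ j ∈ T ] f j a) ≈ ∑[ j ∈ T ] 𝔼 d (f j)
  𝔼-sumOver d T f =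
    trans (𝔼-∑ d (λ j a → if lookup T j then f j a else 0#)) (sum-cong-≋ λ j → 𝔼-if d (lookup T j) (f j))

  𝔼-comm : ∀ (d : Dist A) (e : Dist B) (f : A → B → Carrier) → 𝔼 d (λ a → 𝔼 e (f a)) ≈ 𝔼 e (λ b → 𝔼 d (λ a → f a b))
  𝔼-comm []            e f = sym (𝔼-0 e)
  𝔼-comm ((w , a) ∷ d) e f =
    trans (+-cong (sym (𝔼-*ˡ e w (f a))) (𝔼-comm d e f)) (sym (𝔼-+ e _ _))

  𝔼-++ : ∀ (d e : Dist A) f → 𝔼 (d ++ e) f ≈ 𝔼 d f + 𝔼 e f
  𝔼-++ []      e f = sym (+-identityˡ _)
  𝔼-++ (_ ∷ d) e f = trans (+-congˡ (𝔼-++ d e f)) (sym (+-assoc _ _ _))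

  𝔼-scale : ∀ w (d : Dist A) f → 𝔼 (map (map₁ (w *_)) d) f ≈ w * 𝔼 d f
  𝔼-scale w []            f = sym (zeroʳ w)
  𝔼-scale w ((v , a) ∷ d) f = trans (+-cong (*-assoc w v (f a)) (𝔼-scale w d f)) (sym (distribˡ w _ _))

  𝔼->>= : ∀ (d : Dist A) (e : A → Dist B) f → 𝔼 (d >>= e) f ≈ 𝔼 d (λ a → 𝔼 (e a) f)
  𝔼->>= []            e f = refl
  𝔼->>= ((w , a) ∷ d) e f =
    trans (𝔼-++ (map (map₁ (w *_)) (e a)) _ f) (+-cong (𝔼-scale w (e a) f) (𝔼->>= d e f))

  𝔼-pure : ∀ (a : A) f → 𝔼 (pure a) f ≈ f a
  𝔼-pure a f = trans (+-identityʳ _) (*-identityˡ (f a))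

  𝔼-map-tabulate : ∀ {n} {C : Set} (g : Fin n → C) (w : C → Carrier) (h : C → A) f →
                   𝔼 (map (λ i → w i , h i) (tabulate g)) f ≈ ∑[ i < n ] (w (g i) * f (h (g i)))
  𝔼-map-tabulate {n = zero}  g w h f = refl
  𝔼-map-tabulate {n = suc n} g w h f = +-congˡ (𝔼-map-tabulate (g ∘ suc) w h f)

  0≤𝔼 : ∀ {d : Dist A} {f} → All (λ (w , _) → 0# ≤ w) d → (∀ a → 0# ≤ f a) → 0# ≤ 𝔼 d f
  0≤𝔼 []         0≤f = ≤-refl
  0≤𝔼 (0≤w ∷ ws) 0≤f =
    ≤-trans (≤-reflexive (sym (+-identityˡ 0#))) (+-mono-≤ (*-nonNeg 0≤w (0≤f _)) (0≤𝔼 ws 0≤f))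

  -- The probability is a sum of nonnegative terms; if it vanishes, each term does.
  ℙ≈0⇒weight≈0 : ∀ {d : Dist A} → All (λ (w , _) → 0# ≤ w) d → (event : A → Bool) → ℙ d event ≈ 0# →
                 All (λ (w , a) → event a ≡ true → w ≈ 0#) d
  ℙ≈0⇒weight≈0 []                            event ℙ≈0 = []
  ℙ≈0⇒weight≈0 {d = (w , a) ∷ d} (0≤w ∷ ws) event ℙ≈0 =
    (λ eq → trans (sym (*-identityʳ w)) (trans (*-congˡ (reflexive (≡.cong 𝟙 (≡.sym eq)))) head≈0))
    ∷ ℙ≈0⇒weight≈0 ws event tail≈0
    where
    0≤head = *-nonNeg 0≤w (0≤𝟙 (event a))
    0≤tail = 0≤𝔼 {d = d} ws (0≤𝟙 ∘ event)
    head≈0 : w * 𝟙 (event a) ≈ 0#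
    head≈0 = antisym (≤-trans (≤-reflexive (sym (+-identityʳ _))) (≤-trans (+-mono-≤ ≤-refl 0≤tail) (≤-reflexive ℙ≈0))) 0≤head
    tail≈0 : ℙ d event ≈ 0#
    tail≈0 = antisym (≤-trans (≤-reflexive (sym (+-identityˡ _))) (≤-trans (+-mono-≤ 0≤head ≤-refl) (≤-reflexive ℙ≈0))) 0≤tail

  module _ {d : Dist A} (isProb : IsProbability d) where
    open IsProbability isProb using (nonNeg)

    𝔼-const : ∀ x → 𝔼 d (const x) ≈ x
    𝔼-const x = begin
      𝔼 d (const x)         ≈⟨ 𝔼-cong d (λ _ → sym (*-identityʳ x)) ⟩
      𝔼 d (λ _ → x * 1#)    ≈⟨ 𝔼-*ˡ d x (const 1#) ⟩
      x * 𝔼 d (const 1#)    ≈⟨ *-congˡ (IsProbability.total isProb) ⟩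
      x * 1#                ≈⟨ *-identityʳ x ⟩
      x                     ∎
      where open ≈-Reasoning

    𝔼-mono-≤ : ∀ {f g} → (∀ a → f a ≤ g a) → 𝔼 d f ≤ 𝔼 d g
    𝔼-mono-≤ f≤g = 𝔼-mono-≤-All (All.map (λ 0≤w → *-monoˡ-≤ 0≤w (f≤g _)) nonNeg)

  -- Not normalised: 𝔼 (subsets n) is summation over all subsets of Fin n.
  subsets : ∀ n → Dist (Subset n)
  subsets zero    = pure []
  subsets (suc n) = subsets n >>= λ a → (1# , true ∷ a) ∷ (1# , false ∷ a) ∷ []

  𝔼-subsets-suc : ∀ {n} (f : Subset (suc n) → Carrier) →
                  𝔼 (subsets (suc n)) f ≈ 𝔼 (subsets n) (λ a → f (true ∷ a) + f (false ∷ a))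
  𝔼-subsets-suc {n} f = trans (𝔼->>= (subsets n) (λ a → (1# , true ∷ a) ∷ (1# , false ∷ a) ∷ []) f)
    (𝔼-cong (subsets n) (λ a → +-cong (*-identityˡ _) (trans (+-identityʳ _) (*-identityˡ _))))

  -- `subsets n` lists every subset once with weight `1#`, so the indicator leaves a single term. At
  -- each coordinate one of the two halves vanishes.
  𝔼-subsets-δ : ∀ {n} (ω : Subset n) (f : Subset n → Carrier) → 𝔼 (subsets n) (λ a → 𝟙 (does (≡-dec _≟ᵇ_ ω a)) * f a) ≈ f ω
  𝔼-subsets-δ []          f = trans (𝔼-pure [] (λ a → 𝟙 (does (≡-dec _≟ᵇ_ [] a)) * f a)) (*-identityˡ (f []))
  𝔼-subsets-δ {suc n} (true ∷ ω)  f = trans (𝔼-subsets-suc {n} _) (trans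
    (𝔼-cong (subsets n) (λ a → trans (+-congˡ (zeroˡ _)) (+-identityʳ _))) (𝔼-subsets-δ ω (f ∘ (true ∷_))))
  𝔼-subsets-δ {suc n} (false ∷ ω) f = trans (𝔼-subsets-suc {n} _) (trans
    (𝔼-cong (subsets n) (λ a → trans (+-congʳ (zeroˡ _)) (+-identityˡ _))) (𝔼-subsets-δ ω (f ∘ (false ∷_))))

  mass : ∀ {n} → Dist (Subset n) → Subset n → Carrier
  mass d a = ℙ d (λ ω → does (≡-dec _≟ᵇ_ ω a))

  -- The list `d` may repeat outcomes, whereas `independent` speaks of point masses; this passes
  -- from one view to the other.
  𝔼-by-mass : ∀ {n} (d : Dist (Subset n)) f → 𝔼 d f ≈ 𝔼 (subsets n) (λ a → mass d a * f a)
  𝔼-by-mass {n} d f = sym (begin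
    𝔼 (subsets n) (λ a → mass d a * f a)                                          ≈⟨ 𝔼-cong (subsets n) (λ a → 𝔼-*ʳ d (f a) _) ⟨
    𝔼 (subsets n) (λ a → 𝔼 d (λ ω → 𝟙 (does (≡-dec _≟ᵇ_ ω a)) * f a))             ≈⟨ 𝔼-comm (subsets n) d _ ⟩
    𝔼 d (λ ω → 𝔼 (subsets n) (λ a → 𝟙 (does (≡-dec _≟ᵇ_ ω a)) * f a))             ≈⟨ 𝔼-cong d (λ ω → 𝔼-subsets-δ ω f) ⟩
    𝔼 d f                                                                         ∎)
    where open ≈-Reasoning

  mix : ∀ {n} → Subset n → Subset n → Subset n → Subset n
  mix []          []      []      = []
  mix (true  ∷ A) (x ∷ a) (y ∷ b) = x ∷ mix A a b
  mix (false ∷ A) (x ∷ a) (y ∷ b) = y ∷ mix A a b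

  lookup-mix : ∀ {n} (A a b : Subset n) j → lookup (mix A a b) j ≡ (if lookup A j then lookup a j else lookup b j)
  lookup-mix (true  ∷ A) (x ∷ a) (y ∷ b) zero    = ≡.refl
  lookup-mix (false ∷ A) (x ∷ a) (y ∷ b) zero    = ≡.refl
  lookup-mix (true  ∷ A) (x ∷ a) (y ∷ b) (suc j) = lookup-mix A a b j
  lookup-mix (false ∷ A) (x ∷ a) (y ∷ b) (suc j) = lookup-mix A a b j

  𝔼-subsets²-suc : ∀ {n} (f : Subset (suc n) → Subset (suc n) → Carrier) →
    𝔼 (subsets (suc n)) (λ a → 𝔼 (subsets (suc n)) (f a)) ≈
    𝔼 (subsets n) (λ a → 𝔼 (subsets n) (λ b →
      (f (true ∷ a) (true ∷ b) + f (true ∷ a) (false ∷ b)) + (f (false ∷ a) (true ∷ b) + f (false ∷ a) (false ∷ b))))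
  𝔼-subsets²-suc {n} f = trans (𝔼-subsets-suc {n} _) (𝔼-cong (subsets n) λ a →
    trans (+-cong (𝔼-subsets-suc {n} _) (𝔼-subsets-suc {n} _)) (sym (𝔼-+ (subsets n) _ _)))

  -- The map sending `(a , b)` to `(mix A a b , mix A b a)` is an involution, so it only permutes
  -- the terms of the double sum. Coordinate by coordinate: inside `A` nothing moves, outside `A`
  -- the two mixed terms trade places.
  𝔼-swap : ∀ {n} (A : Subset n) (f : Subset n → Subset n → Carrier) →
           𝔼 (subsets n) (λ a → 𝔼 (subsets n) (f a)) ≈
           𝔼 (subsets n) (λ a → 𝔼 (subsets n) (λ b → f (mix A a b) (mix A b a)))
  𝔼-swap []          f = refl
  𝔼-swap {suc n} (true  ∷ A) f = trans (𝔼-subsets²-suc f) (trans (𝔼-swap A _) (sym (𝔼-subsets²-suc {n} _)))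
  𝔼-swap {suc n} (false ∷ A) f = trans (𝔼-subsets²-suc f) (trans
    (trans (𝔼-cong (subsets n) λ a → 𝔼-cong (subsets n) λ b → +-interchange _ _ _ _) (𝔼-swap A _))
    (sym (𝔼-subsets²-suc {n} _)))

  -- Swapping the parts on A of two independent copies preserves their joint law, and turns
  -- f a * g b into f a * g a.
  independent-on-off : ∀ {n} {d : Dist (Subset n)} → IsProbability d → (A : Subset n) →
    (∀ a b → mass d (mix A a b) * mass d (mix A b a) ≈ mass d a * mass d b) →
    ∀ f g → (∀ a b → f (mix A a b) ≈ f a) → (∀ a b → g (mix A b a) ≈ g a) →
    𝔼 d (λ ω → f ω * g ω) ≈ 𝔼 d f * 𝔼 d g
  independent-on-off {n} {d} isProb A mass-swap f g f-on g-off = sym (begin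
    𝔼 d f * 𝔼 d g
      ≈⟨ *-cong (𝔼-by-mass d f) (𝔼-by-mass d g) ⟩
    𝔼Ω (λ a → μ a * f a) * 𝔼Ω (λ b → μ b * g b)
      ≈⟨ 𝔼-*ʳ (subsets n) _ _ ⟨
    𝔼Ω (λ a → (μ a * f a) * 𝔼Ω (λ b → μ b * g b))
      ≈⟨ 𝔼-cong (subsets n) (λ a → sym (𝔼-*ˡ (subsets n) _ _)) ⟩
    𝔼Ω (λ a → 𝔼Ω (λ b → (μ a * f a) * (μ b * g b)))
      ≈⟨ 𝔼-swap A _ ⟩
    𝔼Ω (λ a → 𝔼Ω (λ b → (μ (mix A a b) * f (mix A a b)) * (μ (mix A b a) * g (mix A b a))))
      -- Now both functions are evaluated at the first copy, and the second copy contributes only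
      -- its total mass.
      ≈⟨ 𝔼-cong (subsets n) (λ a → 𝔼-cong (subsets n) (pointwise a)) ⟩
    𝔼Ω (λ a → 𝔼Ω (λ b → (μ a * (f a * g a)) * (μ b * 1#)))
      ≈⟨ 𝔼-cong (subsets n) (λ a → 𝔼-*ˡ (subsets n) _ _) ⟩
    𝔼Ω (λ a → (μ a * (f a * g a)) * 𝔼Ω (λ b → μ b * 1#))
      ≈⟨ 𝔼-*ʳ (subsets n) _ _ ⟩
    𝔼Ω (λ a → μ a * (f a * g a)) * 𝔼Ω (λ b → μ b * 1#)
      ≈⟨ *-cong (𝔼-by-mass d _) (𝔼-by-mass d _) ⟨
    𝔼 d (λ ω → f ω * g ω) * 𝔼 d (const 1#)
      ≈⟨ trans (*-congˡ (𝔼-const isProb 1#)) (*-identityʳ _) ⟩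
    𝔼 d (λ ω → f ω * g ω) ∎)
    where
    open ≈-Reasoning
    𝔼Ω = 𝔼 (subsets n)
    μ = mass d
    pointwise : ∀ a b → (μ (mix A a b) * f (mix A a b)) * (μ (mix A b a) * g (mix A b a)) ≈ (μ a * (f a * g a)) * (μ b * 1#)
    pointwise a b = begin
      (μ (mix A a b) * f (mix A a b)) * (μ (mix A b a) * g (mix A b a))  ≈⟨ *-interchange _ _ _ _ ⟩
      (μ (mix A a b) * μ (mix A b a)) * (f (mix A a b) * g (mix A b a))  ≈⟨ *-cong (mass-swap a b) (*-cong (f-on a b) (g-off a b)) ⟩
      (μ a * μ b) * (f a * g a)                                          ≈⟨ *-congˡ (*-identityʳ _) ⟨
      (μ a * μ b) * ((f a * g a) * 1#)                                   ≈⟨ *-interchange _ _ _ _ ⟩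
      (μ a * (f a * g a)) * (μ b * 1#)                                   ∎

-- Independence across arrival times and exclusivity within a block.

module Arrivals {c ℓ₁ ℓ₂} {F : OrderedField c ℓ₁ ℓ₂} {m n s u} (P : AdCell F m n s u) where
  open OrderedFieldProperties F
  open Expectation F
  open AdCell P public

  private
    lookup-ext : ∀ {n} {A B : Subset n} → (∀ j → lookup A j ≡ lookup B j) → A ≡ B
    lookup-ext {A = A} {B} eq =
      ≡.trans (≡.sym (tabulate∘lookup A)) (≡.trans (tabulate-cong eq) (tabulate∘lookup B))

  lookup-T∩S : ∀ t k j → lookup (T t ∩ S k) j ≡ does (arrival j ≟ t) ∧ does (customer j ≟ k)
  lookup-T∩S t k j = ≡.trans (lookup-zipWith _∧_ j (T t) (S k))
    (≡.cong₂ _∧_ (lookup∘tabulate _ j) (lookup∘tabulate _ j))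

  lookup-block : ∀ t k a j → lookup (T t ∩ S k ∩ a) j ≡ does (arrival j ≟ t) ∧ does (customer j ≟ k) ∧ lookup a j
  lookup-block t k a j = ≡.trans (lookup-zipWith _∧_ j (T t) (S k ∩ a))
    (≡.cong₂ _∧_ (lookup∘tabulate _ j)
      (≡.trans (lookup-zipWith _∧_ j (S k) a) (≡.cong (_∧ lookup a j) (lookup∘tabulate _ j))))

  -- The splice is made along a whole arrival time, so every block lies entirely inside `T t` or
  -- entirely outside it and is never cut.
  block-mix : ∀ t t′ k a b → T t′ ∩ S k ∩ mix (T t) a b ≡ (if does (t ≟ t′) then T t′ ∩ S k ∩ a else T t′ ∩ S k ∩ b)
  block-mix t t′ k a b with t ≟ t′
  ... | yes ≡.refl = lookup-ext λ j → ≡.trans (lookup-block t k _ j) (≡.trans (go j) (≡.sym (lookup-block t k a j)))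
    where
    go : ∀ j → does (arrival j ≟ t) ∧ does (customer j ≟ k) ∧ lookup (mix (T t) a b) j ≡
               does (arrival j ≟ t) ∧ does (customer j ≟ k) ∧ lookup a j
    go j rewrite lookup-mix (T t) a b j | lookup∘tabulate (λ j → does (arrival j ≟ t)) j with does (arrival j ≟ t)
    ... | true  = ≡.refl
    ... | false = ≡.refl
  ... | no t≢t′ = lookup-ext λ j → ≡.trans (lookup-block t′ k _ j) (≡.trans (go j) (≡.sym (lookup-block t′ k b j)))
    where
    go : ∀ j → does (arrival j ≟ t′) ∧ does (customer j ≟ k) ∧ lookup (mix (T t) a b) j ≡
               does (arrival j ≟ t′) ∧ does (customer j ≟ k) ∧ lookup b j
    go j rewrite lookup-mix (T t) a b j | lookup∘tabulate (λ j → does (arrival j ≟ t)) j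
      with arrival j ≟ t′ | arrival j ≟ t
    ... | no _       | _          = ≡.refl
    ... | yes _      | no _       = ≡.refl
    ... | yes ≡.refl | yes ≡.refl = ⊥-elim (t≢t′ ≡.refl)

  module Π = CommutativeMonoidSum *-commutativeMonoid

  -- By `independent` both sides are products over the blocks. By `block-mix` each block either
  -- keeps its two factors or exchanges them, and the product of the two is the same.
  mass-mix : ∀ t a b → mass arrivals (mix (T t) a b) * mass arrivals (mix (T t) b a) ≈ mass arrivals a * mass arrivals b
  mass-mix t a b = begin
    mass arrivals (mix (T t) a b) * mass arrivals (mix (T t) b a)  ≈⟨ *-cong (independent _) (independent _) ⟩
    ΠΠ (mix (T t) a b) * ΠΠ (mix (T t) b a)                        ≈⟨ ΠΠ-* _ _ ⟨
    Π.sum {s} (λ k → Π.sum {u} (λ t′ → ν k t′ (mix (T t) a b) * ν k t′ (mix (T t) b a)))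
                                                                   ≈⟨ Π.sum-cong-≋ {s} (λ k → Π.sum-cong-≋ {u} (factor k)) ⟩
    Π.sum {s} (λ k → Π.sum {u} (λ t′ → ν k t′ a * ν k t′ b))       ≈⟨ ΠΠ-* a b ⟩
    ΠΠ a * ΠΠ b                                                    ≈⟨ *-cong (independent a) (independent b) ⟨
    mass arrivals a * mass arrivals b                              ∎
    where
    open ≈-Reasoning
    law : Fin s → Fin u → Subset n → Carrier
    law k t′ A = ℙ arrivals (λ ω → does (≡-dec _≟ᵇ_ (T t′ ∩ S k ∩ ω) A))
    ν : Fin s → Fin u → Subset n → Carrier
    ν k t′ a = law k t′ (T t′ ∩ S k ∩ a)
    ΠΠ : Subset n → Carrier
    ΠΠ a = product {s} (λ k → product {u} (λ t′ → ν k t′ a))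
    ΠΠ-* : ∀ a b → Π.sum {s} (λ k → Π.sum {u} (λ t′ → ν k t′ a * ν k t′ b)) ≈ ΠΠ a * ΠΠ b
    ΠΠ-* a b = trans (Π.sum-cong-≋ {s} λ k → Π.∑-distrib-+ {u} (λ t′ → ν k t′ a) (λ t′ → ν k t′ b)) (Π.∑-distrib-+ {s} _ _)
    factor : ∀ k t′ → ν k t′ (mix (T t) a b) * ν k t′ (mix (T t) b a) ≈ ν k t′ a * ν k t′ b
    factor k t′ rewrite block-mix t t′ k a b | block-mix t t′ k b a with does (t ≟ t′)
    ... | true  = refl
    ... | false = *-comm _ _

  -- The locality hypotheses say that `f` looks only at the queries of `T t` and `g` only at the
  -- others. Later `f` is the arrival of one query and `g` the value of the queries of later blocks.
  independent-of-T : ∀ t (f g : Subset n → Carrier) →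
    (∀ ω ω′ → (∀ j → arrival j ≡ t → lookup ω j ≡ lookup ω′ j) → f ω ≈ f ω′) →
    (∀ ω ω′ → (∀ j → arrival j ≢ t → lookup ω j ≡ lookup ω′ j) → g ω ≈ g ω′) →
    𝔼 arrivals (λ ω → f ω * g ω) ≈ 𝔼 arrivals f * 𝔼 arrivals g
  independent-of-T t f g f-local g-local = independent-on-off isProbability (T t) (mass-mix t) f g
    (λ a b → f-local _ _ (λ j → on a b j))
    (λ a b → g-local _ _ (λ j → off b a j))
    where
    on : ∀ a b j → arrival j ≡ t → lookup (mix (T t) a b) j ≡ lookup a j
    on a b j eq rewrite lookup-mix (T t) a b j | lookup∘tabulate (λ j → does (arrival j ≟ t)) j with arrival j ≟ t
    ... | yes _  = ≡.refl
    ... | no neq = ⊥-elim (neq eq)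
    off : ∀ a b j → arrival j ≢ t → lookup (mix (T t) a b) j ≡ lookup b j
    off a b j neq rewrite lookup-mix (T t) a b j | lookup∘tabulate (λ j → does (arrival j ≟ t)) j with arrival j ≟ t
    ... | yes eq = ⊥-elim (neq eq)
    ... | no _   = ≡.refl

  Exclusive : Subset n → Set
  Exclusive ω = ∀ j j′ → j ≢ j′ → customer j ≡ customer j′ → arrival j ≡ arrival j′ →
                lookup ω j ∧ lookup ω j′ ≡ false

  -- The model makes simultaneous arrivals null events only, so the list may contain outcomes
  -- violating exclusivity. By nonnegativity such outcomes have weight zero.
  exclusive-or-null : All (λ (w , ω) → w ≈ 0# ⊎ Exclusive ω) arrivals
  exclusive-or-null = All.tabulate go
    where
    go : ∀ {wω} → wω ∈ arrivals → proj₁ wω ≈ 0# ⊎ Exclusive (proj₂ wω)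
    go {w , ω} wω∈ with w ≈? 0#
    ... | yes w≈0 = inj₁ w≈0
    ... | no  w≉0 = inj₂ λ j j′ j≢j′ k≡ t≡ → ¬-not λ both →
      w≉0 (All.lookup (ℙ≈0⇒weight≈0 (IsProbability.nonNeg isProbability) _ (exclusive j j′ j≢j′ k≡ t≡)) wω∈ both)

  𝔼-cong-exclusive : ∀ {f g} → (∀ ω → Exclusive ω → f ω ≈ g ω) → 𝔼 arrivals f ≈ 𝔼 arrivals g
  𝔼-cong-exclusive f≈g = 𝔼-cong-All (All.map
    (λ { (inj₁ w≈0) → trans (*-congʳ w≈0) (trans (zeroˡ _) (sym (trans (*-congʳ w≈0) (zeroˡ _))))
       ; (inj₂ ex)  → *-congˡ (f≈g _ ex) })
    exclusive-or-null)

  𝔼-mono-≤-exclusive : ∀ {f g} → (∀ ω → Exclusive ω → f ω ≤ g ω) → 𝔼 arrivals f ≤ 𝔼 arrivals g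
  𝔼-mono-≤-exclusive f≤g = 𝔼-mono-≤-All (All.zipWith
    (λ { (_ , inj₁ w≈0)   → ≤-reflexive (trans (*-congʳ w≈0) (trans (zeroˡ _) (sym (trans (*-congʳ w≈0) (zeroˡ _)))))
       ; (0≤w , inj₂ ex) → *-monoˡ-≤ 0≤w (f≤g _ ex) })
    (IsProbability.nonNeg isProbability , exclusive-or-null))

  -- The left side is the expected number of arrivals in the block, and almost surely at most one of
  -- its queries arrives.
  block-mass≤1 : ∀ t k → ∑[ j ∈ T t ∩ S k ] p j ≤ 1#
  block-mass≤1 t k = begin
    ∑[ j ∈ T t ∩ S k ] p j                                       ≈⟨ sumOver-cong (T t ∩ S k) marginal ⟨
    ∑[ j ∈ T t ∩ S k ] 𝔼 arrivals (λ ω → 𝟙 (lookup ω j))         ≈⟨ 𝔼-sumOver arrivals (T t ∩ S k) (λ j ω → 𝟙 (lookup ω j)) ⟨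
    𝔼 arrivals (λ ω → ∑[ j ∈ T t ∩ S k ] 𝟙 (lookup ω j))         ≤⟨ 𝔼-mono-≤-exclusive at-most-one ⟩
    𝔼 arrivals (const 1#)                                        ≈⟨ 𝔼-const isProbability 1# ⟩
    1#                                                           ∎
    where
    open ≤-Reasoning
    at-most-one : ∀ ω → Exclusive ω → ∑[ j ∈ T t ∩ S k ] 𝟙 (lookup ω j) ≤ 1#
    at-most-one ω excl = ≤-trans (≤-reflexive (sum-cong-≋ λ j → merge (lookup (T t ∩ S k) j) (lookup ω j)))
                                 (count≤1 (λ j → lookup (T t ∩ S k) j ∧ lookup ω j) disjoint)
      where
      merge : ∀ x y → (if x then 𝟙 y else 0#) ≈ 𝟙 (x ∧ y)
      merge true  y = refl
      merge false y = refl
      disjoint : ∀ i j → i ≢ j → (lookup (T t ∩ S k) i ∧ lookup ω i) ∧ (lookup (T t ∩ S k) j ∧ lookup ω j) ≡ false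
      disjoint i j i≢j rewrite lookup-T∩S t k i | lookup-T∩S t k j
        with arrival i ≟ t | customer i ≟ k | arrival j ≟ t | customer j ≟ k
      ... | yes i-at-t | yes i-at-k | yes j-at-t | yes j-at-k =
        excl i j i≢j (≡.trans i-at-k (≡.sym j-at-k)) (≡.trans i-at-t (≡.sym j-at-t))
      ... | no _      | _         | _         | _         = ≡.refl
      ... | yes _     | no _      | _         | _         = ≡.refl
      ... | yes _     | yes _     | no _      | _         = ∧-zeroʳ _
      ... | yes _     | yes _     | yes _     | no _      = ∧-zeroʳ _

-- The expected revenue from one customer for a fixed arrival set.

module Revenue {c ℓ₁ ℓ₂} {F : OrderedField c ℓ₁ ℓ₂} {m n s u} (P : AdCell F m n s u)
               (x : Fin m → Fin n → OrderedField.Carrier F) where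
  open OrderedFieldProperties F
  open Expectation F
  open Arrivals P
  open Allocations P
  open AlgorithmB P x

  -- The test of `X` is outermost, so that changing one entry of `X` changes one term through a
  -- single Boolean.
  revenueFrom : Fin s → Allocation → Carrier
  revenueFrom k X = ∑[ i < m ] ∑[ j < n ] (if X i j then (if lookup (S k) j then bid i j else 0#) else 0#)

  revenue-by-customer : ∀ X → revenue X ≈ ∑[ k < s ] revenueFrom k X
  revenue-by-customer X = sym (begin
    ∑[ k < s ] ∑[ i < m ] ∑[ j < n ] (if X i j then (if lookup (S k) j then bid i j else 0#) else 0#)
      ≈⟨ ∑-comm {s} {m} _ ⟩
    ∑[ i < m ] ∑[ k < s ] ∑[ j < n ] (if X i j then (if lookup (S k) j then bid i j else 0#) else 0#)
      ≈⟨ sum-cong-≋ {m} (λ i → sum-cong-≋ {s} λ k → sum-cong-≋ {n} λ j → swap-if i k j) ⟩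
    ∑[ i < m ] ∑[ k < s ] ∑[ j < n ] (if does (customer j ≟ k) then (if X i j then bid i j else 0#) else 0#)
      ≈⟨ sum-cong-≋ {m} (λ i → ∑-fibres customer _) ⟩
    revenue X ∎)
    where
    open ≈-Reasoning
    swap-if : ∀ i k j → (if X i j then (if lookup (S k) j then bid i j else 0#) else 0#) ≈
                        (if does (customer j ≟ k) then (if X i j then bid i j else 0#) else 0#)
    swap-if i k j rewrite lookup∘tabulate (λ j → does (customer j ≟ k)) j with X i j | does (customer j ≟ k)
    ... | true  | _     = refl
    ... | false | true  = refl
    ... | false | false = refl

  allocate-here : ∀ i j X → allocate i j X i j ≡ true
  allocate-here i j X rewrite updateAt-updates i {λ row → updateAt row j (const true)} X = updateAt-updates j (X i)

  allocate-row : ∀ i j X {i′} → i′ ≢ i → ∀ j′ → allocate i j X i′ j′ ≡ X i′ j′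
  allocate-row i j X {i′} i′≢i j′ = ≡.cong (λ row → row j′) (updateAt-minimal i′ i {λ row → updateAt row j (const true)} X i′≢i)

  allocate-column : ∀ i j X i′ {j′} → j′ ≢ j → allocate i j X i′ j′ ≡ X i′ j′
  allocate-column i j X i′ {j′} j′≢j with i′ ≟ i
  ... | no i′≢i    = allocate-row i j X i′≢i j′
  ... | yes ≡.refl rewrite updateAt-updates i {λ row → updateAt row j (const true)} X = updateAt-minimal j′ j (X i) j′≢j

  -- Only the entry at `i` and `j` changes: a one-entry update inside a one-row update. That the
  -- entry was `false` makes the bid count as new.
  revenueFrom-allocate : ∀ k i j X → X i j ≡ false →
    revenueFrom k (allocate i j X) ≈ revenueFrom k X + (if does (customer j ≟ k) then bid i j else 0#)
  revenueFrom-allocate k i j X free = sum-update i _ _ _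
    (λ i′ i′≢i → sum-cong-≋ {n} λ j′ → reflexive (≡.cong (value i′ j′) (allocate-row i j X i′≢i j′)))
    (sum-update j _ _ _
      (λ j′ j′≢j → reflexive (≡.cong (value i j′) (allocate-column i j X i j′≢j)))
      here)
    where
    value : Fin m → Fin n → Bool → Carrier
    value i′ j′ b = if b then (if lookup (S k) j′ then bid i′ j′ else 0#) else 0#
    here : value i j (allocate i j X i j) ≈ value i j (X i j) + (if does (customer j ≟ k) then bid i j else 0#)
    here rewrite allocate-here i j X | free | lookup∘tabulate (λ j → does (customer j ≟ k)) j = sym (+-identityˡ _)

  used-allocate : ∀ k i j X → X i j ≡ false →
    used (allocate i j X) k ≡ used X k ℕ.+ toℕ (does (customer j ≟ k))
  used-allocate k i j X free = ℕsum-update j _ _ _ (λ j′ j′≢j → count-other j′ j′≢j) count-here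
    where
    open SumUpdate ℕₚ.+-0-commutativeMonoid using () renaming (sum-update to ℕsum-update)
    module ℕΣ = CommutativeMonoidSum ℕₚ.+-0-commutativeMonoid
    count-other : ∀ j′ → j′ ≢ j →
      (if lookup (S k) j′ then sumℕ (λ i′ → toℕ (allocate i j X i′ j′)) else 0) ≡
      (if lookup (S k) j′ then sumℕ (λ i′ → toℕ (X i′ j′)) else 0)
    count-other j′ j′≢j = ≡.cong (if lookup (S k) j′ then_else 0)
      (ℕΣ.sum-cong-≋ λ i′ → ≡.cong toℕ (allocate-column i j X i′ j′≢j))
    column : sumℕ (λ i′ → toℕ (allocate i j X i′ j)) ≡ sumℕ (λ i′ → toℕ (X i′ j)) ℕ.+ 1
    column = ℕsum-update i _ _ 1 (λ i′ i′≢i → ≡.cong toℕ (allocate-row i j X i′≢i j))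
      (≡.trans (≡.cong toℕ (allocate-here i j X)) (≡.cong (λ b → toℕ b ℕ.+ 1) (≡.sym free)))
    count-here :
      (if lookup (S k) j then sumℕ (λ i′ → toℕ (allocate i j X i′ j)) else 0) ≡
      (if lookup (S k) j then sumℕ (λ i′ → toℕ (X i′ j)) else 0) ℕ.+ toℕ (does (customer j ≟ k))
    count-here rewrite lookup∘tabulate (λ j → does (customer j ≟ k)) j with does (customer j ≟ k)
    ... | true  = column
    ... | false = ≡.refl

  share : Fin n → Fin m → Carrier
  share j i = x i j / p j

  p*share≈x : ∀ i j → p j * share j i ≈ x i j
  p*share≈x i j = begin
    p j * (x i j * p j ⁻¹)  ≈⟨ *-swapˡ _ _ _ ⟩
    x i j * (p j * p j ⁻¹)  ≈⟨ *-congˡ (⁻¹-inverseʳ λ p≈0 → proj₂ (p>0 j) (sym p≈0)) ⟩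
    x i j * 1#              ≈⟨ *-identityʳ _ ⟩
    x i j                   ∎
    where open ≈-Reasoning

  -- What choosing `i` adds over discarding `j`. Acceptance follows the values `E`, while the future
  -- is measured by an arbitrary `G`, because `G` will be both the random future gain and its
  -- expectation. `ℕ.pred` is harmless at `0`, where `accepts` is `false`.
  increment : Fin m → Fin n → (ℕ → Carrier) → ℕ → Carrier
  increment i j G r = if accepts i j r then bid i j + G (ℕ.pred r) - G r else 0#

  meanIncrement : Fin n → (ℕ → Carrier) → ℕ → Carrier
  meanIncrement j G r = ∑[ i < m ] (share j i * increment i j G r)

  -- The expected future revenue from customer k with remaining capacity r, given the arrival set ω
  -- and the queries js still to be processed.
  gain : Fin s → Subset n → List (Fin n) → ℕ → Carrier
  gain k ω []       r = 0#
  gain k ω (j ∷ js) r =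
    gain k ω js r + (if lookup ω j ∧ does (customer j ≟ k) then meanIncrement j (gain k ω js) r else 0#)

  -- The weights of `choose j` add up to one, so the value of discarding counts once and only the
  -- differences from it are weighted by `share j`.
  𝔼-choose : ∀ j (h : Maybe (Fin m) → Carrier) (d : Fin m → Carrier) → (∀ i → h (just i) ≈ h nothing + d i) →
             𝔼 (choose j) h ≈ h nothing + ∑[ i < m ] (share j i * d i)
  𝔼-choose j h d h-just = begin
    (1# - σ) * h nothing + 𝔼 (map (λ i → share j i , just i) (allFin m)) h
      ≈⟨ +-congˡ (𝔼-map-tabulate id (share j) just h) ⟩
    (1# - σ) * h nothing + ∑[ i < m ] (share j i * h (just i))
      ≈⟨ +-congˡ (sum-cong-≋ λ i → trans (*-congˡ (h-just i)) (distribˡ _ _ _)) ⟩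
    (1# - σ) * h nothing + ∑[ i < m ] (share j i * h nothing + share j i * d i)
      ≈⟨ +-congˡ (∑-distrib-+ {m} _ _) ⟩
    (1# - σ) * h nothing + (∑[ i < m ] (share j i * h nothing) + ∑[ i < m ] (share j i * d i))
      ≈⟨ +-assoc _ _ _ ⟨
    (1# - σ) * h nothing + ∑[ i < m ] (share j i * h nothing) + ∑[ i < m ] (share j i * d i)
      ≈⟨ +-congʳ (+-congˡ (*-distribʳ-sum {m} (h nothing) (share j))) ⟨
    (1# - σ) * h nothing + σ * h nothing + ∑[ i < m ] (share j i * d i)
      ≈⟨ +-congʳ ([1-a]x+ax≈x σ (h nothing)) ⟩
    h nothing + ∑[ i < m ] (share j i * d i) ∎
    where
    open ≈-Reasoning
    σ = ∑[ i < m ] share j i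

  -- The invariant of a run: queries not yet processed are unallocated, so each acceptance sets a
  -- fresh entry.
  Free : Allocation → List (Fin n) → Set
  Free X = All (λ j → ∀ i → X i j ≡ false)

  Free-allocate : ∀ {i j X js} → All (j ≢_) js → Free X js → Free (allocate i j X) js
  Free-allocate []         []       = []
  Free-allocate {i} {j} {X} (j≢j′ ∷ ≢s) (f ∷ fs) =
    (λ i′ → ≡.trans (allocate-column i j X i′ (j≢j′ ∘ ≡.sym)) (f i′)) ∷ Free-allocate ≢s fs

  remaining : Allocation → Fin s → ℕ
  remaining X k = capacity k ∸ used X k

  -- Here the customers decouple. Processing a query of another customer changes neither
  -- `revenueFrom k` nor the remaining capacity of `k`; accepting a query of `k` adds its bid and
  -- moves `r` to its predecessor, which is exactly `increment`.
  𝔼-run : ∀ k ω js X → Unique js → Free X js →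
          𝔼 (run ω js X) (revenueFrom k) ≈ revenueFrom k X + gain k ω js (remaining X k)
  𝔼-run k ω []       X _          _          = trans (𝔼-pure X (revenueFrom k)) (sym (+-identityʳ _))
  𝔼-run k ω (j ∷ js) X (j≢ ∷ !js) (fj ∷ fjs) = trans (𝔼->>= (process ω j X) (run ω js) _) step
    where
    open ≈-Reasoning
    r = remaining X k
    G = gain k ω js
    after : Allocation → Carrier
    after Y = 𝔼 (run ω js Y) (revenueFrom k)
    h : Maybe (Fin m) → Carrier
    h choice = after (decide j choice X)

    h-nothing : h nothing ≈ revenueFrom k X + G r
    h-nothing = 𝔼-run k ω js X !js fjs

    δ : Fin m → Carrier
    δ i = if does (customer j ≟ k) then increment i j G r else 0#

    h-just : ∀ i → h (just i) ≈ h nothing + δ i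
    h-just i with accepts i j (remaining X (customer j)) in acc
    ... | false = trans (sym (+-identityʳ _)) (+-congˡ (sym δ≈0))
      where
      δ≈0 : δ i ≈ 0#
      δ≈0 with customer j ≟ k
      ... | no _       = refl
      ... | yes ≡.refl rewrite acc = refl
    ... | true = begin
      𝔼 (run ω js X′) (revenueFrom k)              ≈⟨ 𝔼-run k ω js X′ !js (Free-allocate j≢ fjs) ⟩
      revenueFrom k X′ + G (remaining X′ k)        ≈⟨ accepted ⟩
      (revenueFrom k X + G r) + δ i                ≈⟨ +-congʳ h-nothing ⟨
      h nothing + δ i                              ∎
      where
      X′ = allocate i j X
      accepted : revenueFrom k X′ + G (remaining X′ k) ≈ (revenueFrom k X + G r) + δ i
      accepted with revenueFrom-allocate k i j X (fj i) | used-allocate k i j X (fj i)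
      ... | rev≈ | used≡ with customer j ≟ k
      ... | no _ rewrite ≡.trans used≡ (ℕₚ.+-identityʳ (used X k)) =
        trans (+-congʳ (trans rev≈ (+-identityʳ _))) (sym (+-identityʳ _))
      ... | yes ≡.refl rewrite acc = begin
        revenueFrom k X′ + G (remaining X′ k)
          ≈⟨ +-cong rev≈ (reflexive (≡.cong G remaining≡)) ⟩
        (revenueFrom k X + bid i j) + G (ℕ.pred r)
          ≈⟨ +-assoc _ _ _ ⟩
        revenueFrom k X + (bid i j + G (ℕ.pred r))
          ≈⟨ +-congˡ (x+[y-x]≈y (G r) _) ⟨
        revenueFrom k X + (G r + (bid i j + G (ℕ.pred r) - G r))
          ≈⟨ +-assoc _ _ _ ⟨
        (revenueFrom k X + G r) + (bid i j + G (ℕ.pred r) - G r) ∎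
        where
        remaining≡ : remaining X′ k ≡ ℕ.pred r
        remaining≡ = ≡.trans (≡.cong (capacity k ∸_) (≡.trans used≡ (ℕₚ.+-comm (used X k) 1)))
                             (≡.sym (ℕₚ.pred[m∸n]≡m∸[1+n] (capacity k) (used X k)))

    𝔼-δ : ∑[ i < m ] (share j i * δ i) ≈ (if does (customer j ≟ k) then meanIncrement j G r else 0#)
    𝔼-δ with does (customer j ≟ k)
    ... | true  = refl
    ... | false = sum-zero {m} λ i → zeroʳ _

    step : 𝔼 (process ω j X) after ≈ revenueFrom k X + gain k ω (j ∷ js) r
    step with lookup ω j
    ... | false = trans (𝔼-pure X after) (trans h-nothing (+-congˡ (sym (+-identityʳ _))))
    ... | true  = begin
      𝔼 (choose j >>= λ choice → pure (decide j choice X)) after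
        ≈⟨ 𝔼->>= (choose j) (λ choice → pure (decide j choice X)) after ⟩
      𝔼 (choose j) (λ choice → 𝔼 (pure (decide j choice X)) after)
        ≈⟨ 𝔼-cong (choose j) (λ choice → 𝔼-pure (decide j choice X) after) ⟩
      𝔼 (choose j) h
        ≈⟨ 𝔼-choose j h δ h-just ⟩
      h nothing + ∑[ i < m ] (share j i * δ i)
        ≈⟨ +-cong h-nothing 𝔼-δ ⟩
      (revenueFrom k X + G r) + (if does (customer j ≟ k) then meanIncrement j G r else 0#)
        ≈⟨ +-assoc _ _ _ ⟩
      revenueFrom k X + (G r + (if does (customer j ≟ k) then meanIncrement j G r else 0#)) ∎

-- The expected revenue of the algorithm equals the dynamic-programming value.

module ExpectedRevenue {c ℓ₁ ℓ₂} {F : OrderedField c ℓ₁ ℓ₂} {m n s u} (P : AdCell F m n s u)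
                       (x : Fin m → Fin n → OrderedField.Carrier F) where
  open OrderedFieldProperties F
  open Expectation F
  open Arrivals P
  open Allocations P
  open AlgorithmB P x
  open Revenue P x

  increment-cong : ∀ i j {G H} r → (∀ r → G r ≈ H r) → increment i j G r ≈ increment i j H r
  increment-cong i j r G≈H = if-cong (accepts i j r) (+-cong (+-congˡ (G≈H _)) (-‿cong (G≈H _)))

  meanIncrement-cong : ∀ j {G H} r → (∀ r → G r ≈ H r) → meanIncrement j G r ≈ meanIncrement j H r
  meanIncrement-cong j r G≈H = sum-cong-≋ {m} λ i → *-congˡ (increment-cong i j r G≈H)

  -- For fixed `r`, `meanIncrement` is affine in `G`, since acceptance does not depend on `G`. Hence
  -- the expectation moves inside, the constant bids being preserved by total mass one.
  𝔼-meanIncrement : ∀ {A} {d : Dist A} → IsProbability d → ∀ j (G : A → ℕ → Carrier) r →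
    𝔼 d (λ a → meanIncrement j (G a) r) ≈ meanIncrement j (λ r → 𝔼 d (λ a → G a r)) r
  𝔼-meanIncrement {d = d} isProb j G r =
    trans (𝔼-∑ d (λ i a → share j i * increment i j (G a) r)) (sum-cong-≋ {m} λ i → trans (𝔼-*ˡ d _ _) (*-congˡ (inner i)))
    where
    inner : ∀ i → 𝔼 d (λ a → increment i j (G a) r) ≈ increment i j (λ r → 𝔼 d (λ a → G a r)) r
    inner i = trans (𝔼-if d (accepts i j r) _) (if-cong (accepts i j r)
      (trans (𝔼-+ d _ _) (+-cong (trans (𝔼-+ d _ _) (+-congʳ (𝔼-const isProb _))) (𝔼-neg d _))))

  -- With no capacity left `accepts` is `false`, so every increment vanishes.
  gain-0 : ∀ k ω js → gain k ω js 0 ≈ 0#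
  gain-0 k ω []       = refl
  gain-0 k ω (j ∷ js) = trans (+-cong (gain-0 k ω js) (last (lookup ω j ∧ does (customer j ≟ k)))) (+-identityˡ 0#)
    where
    last : ∀ b → (if b then meanIncrement j (gain k ω js) 0 else 0#) ≈ 0#
    last true  = sum-zero {m} λ i → zeroʳ _
    last false = refl

  -- Supplies the locality that `independent-of-T` demands of the value of the later queries.
  gain-cong : ∀ k {ω ω′ js} r → All (λ j → lookup ω j ≡ lookup ω′ j) js → gain k ω js r ≈ gain k ω′ js r
  gain-cong k r [] = refl
  gain-cong k {ω} {ω′} {j ∷ js} r (eq ∷ eqs) rewrite eq =
    +-cong (gain-cong k r eqs)
           (if-cong (lookup ω′ j ∧ does (customer j ≟ k)) (meanIncrement-cong j r λ r → gain-cong k r eqs))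

  contribution : Fin s → Subset n → (ℕ → Carrier) → ℕ → Fin n → Carrier
  contribution k ω G r j = if lookup ω j ∧ does (customer j ≟ k) then meanIncrement j G r else 0#

  Idle : Fin s → Subset n → Fin n → Set
  Idle k ω j = lookup ω j ∧ does (customer j ≟ k) ≡ false

  gain-idle : ∀ k ω {js} rest r → All (Idle k ω) js → gain k ω (js ++ rest) r ≈ gain k ω rest r
  gain-idle k ω rest r []              = refl
  gain-idle k ω rest r (idle ∷ idles) rewrite idle = trans (+-identityʳ _) (gain-idle k ω rest r idles)

  contributions-idle : ∀ k ω G r {js} → All (Idle k ω) js → listSum (contribution k ω G r) js ≈ 0#
  contributions-idle k ω G r []              = refl
  contributions-idle k ω G r (idle ∷ idles) rewrite idle = trans (+-identityˡ _) (contributions-idle k ω G r idles)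

  -- Once a query of `k` arrives, exclusivity makes the other queries of `k` in the block absent.
  -- Its increment is therefore measured against `rest` alone, and the nested recursion flattens to
  -- a sum.
  gain-block : ∀ k {ω} → Exclusive ω → ∀ t {js} rest r → Unique js → All (λ j → arrival j ≡ t) js →
               gain k ω (js ++ rest) r ≈ gain k ω rest r + listSum (contribution k ω (gain k ω rest) r) js
  gain-block k excl t rest r [] [] = sym (+-identityʳ _)
  gain-block k {ω} excl t {j ∷ js} rest r (j≢ ∷ !js) (at-t ∷ ats)
    with lookup ω j in arrives | customer j ≟ k
  ... | false | _    = trans (+-identityʳ _) (trans (gain-block k excl t rest r !js ats) (+-congˡ (sym (+-identityˡ _))))
  ... | true  | no _ = trans (+-identityʳ _) (trans (gain-block k excl t rest r !js ats) (+-congˡ (sym (+-identityˡ _))))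
  ... | true  | yes at-k = +-cong (gain-idle k ω rest r idles)
    (trans (meanIncrement-cong j r (λ r → gain-idle k ω rest r idles))
           (sym (trans (+-congˡ (contributions-idle k ω (gain k ω rest) r idles)) (+-identityʳ _))))
    where
    idle : ∀ {j′} → j ≢ j′ × arrival j′ ≡ t → Idle k ω j′
    idle {j′} (j≢j′ , at-t′) with customer j′ ≟ k
    ... | no _      = ∧-zeroʳ _
    ... | yes at-k′ = ≡.trans (∧-identityʳ _) (≡.trans (≡.cong (_∧ lookup ω j′) (≡.sym arrives))
      (excl j j′ j≢j′ (≡.trans at-k (≡.sym at-k′)) (≡.trans at-t (≡.sym at-t′))))
    idles : All (Idle k ω) js
    idles = All.zipWith idle (j≢ , ats)

  block : Fin u → List (Fin n)
  block t = filter (λ j → arrival j ≟ t) (allFin n)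

  block-arrival : ∀ t → All (λ j → arrival j ≡ t) (block t)
  block-arrival t = Allₚ.all-filter (λ j → arrival j ≟ t) (allFin n)

  -- The factor `p j` cancels the division in `share`. The acceptance test picks the larger
  -- alternative: accepting attains the maximum, and rejecting leaves a difference of zero.
  p*meanIncrement : ∀ j r → let W = E (customer j) (suc (arrival j)) in
    p j * meanIncrement j W (suc r) ≈ ∑[ i < m ] (x i j * (max (bid i j + W r) (W (suc r)) - W (suc r)))
  p*meanIncrement j r = trans (*-distribˡ-sum {m} (p j) _) (sum-cong-≋ {m} λ i →
    trans (sym (*-assoc _ _ _)) (*-cong (p*share≈x i j) (increment≈ i)))
    where
    W = E (customer j) (suc (arrival j))
    increment≈ : ∀ i → increment i j W (suc r) ≈ max (bid i j + W r) (W (suc r)) - W (suc r)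
    increment≈ i with W (suc r) ≤? bid i j + W r
    ... | yes le = +-congʳ (sym (y≤x⇒max≈x le))
    ... | no nle with total (bid i j + W r) (W (suc r))
    ...   | inj₁ ge = sym (trans (+-congʳ (x≤y⇒max≈y ge)) (-‿inverseʳ _))
    ...   | inj₂ le = ⊥-elim (nle le)

  -- One step of the backward induction, with `𝔼-rest` as induction hypothesis for the later queries
  -- `rest`.
  module _ (k : Fin s) (t : Fin u) {rest : List (Fin n)} (later : All (λ j → arrival j ≢ t) rest)
           (𝔼-rest : ∀ r → 𝔼 arrivals (λ ω → gain k ω rest r) ≈ E k (suc t) r) where

    W = E k (suc t)

    surplus : ℕ → Fin n → Carrier
    surplus r j = ∑[ i < m ] (x i j * (max (bid i j + W r) (W (suc r)) - W (suc r)))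

    -- The arrival of `j` is decided within `T t` and the gain from `rest` outside it, so the
    -- expectation factors.
    𝔼-arrival*meanIncrement : ∀ r j → arrival j ≡ t → customer j ≡ k →
      𝔼 arrivals (λ ω → 𝟙 (lookup ω j) * meanIncrement j (gain k ω rest) (suc r)) ≈ surplus r j
    𝔼-arrival*meanIncrement r j ≡.refl ≡.refl = begin
      𝔼 arrivals (λ ω → 𝟙 (lookup ω j) * meanIncrement j (gain k ω rest) (suc r))
        ≈⟨ independent-of-T t _ _
             (λ ω ω′ same → reflexive (≡.cong 𝟙 (same j ≡.refl)))
             (λ ω ω′ same → meanIncrement-cong j (suc r) λ r → gain-cong k r (All.map (λ {j} → same j) later)) ⟩
      ℙ arrivals (λ ω → lookup ω j) * 𝔼 arrivals (λ ω → meanIncrement j (gain k ω rest) (suc r))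
        ≈⟨ *-cong (marginal j) (𝔼-meanIncrement isProbability j (λ ω → gain k ω rest) (suc r)) ⟩
      p j * meanIncrement j (λ r → 𝔼 arrivals (λ ω → gain k ω rest r)) (suc r)
        ≈⟨ *-congˡ (meanIncrement-cong j (suc r) 𝔼-rest) ⟩
      p j * meanIncrement j W (suc r)
        ≈⟨ p*meanIncrement j r ⟩
      surplus r j ∎
      where open ≈-Reasoning

    𝔼-contribution : ∀ r j →
      𝔼 arrivals (λ ω → if does (arrival j ≟ t) then contribution k ω (gain k ω rest) (suc r) j else 0#) ≈
      (if lookup (T t ∩ S k) j then surplus r j else 0#)
    𝔼-contribution r j rewrite lookup-T∩S t k j with arrival j ≟ t | customer j ≟ k
    ... | no _     | _        = 𝔼-0 arrivals
    ... | yes at-t | no _     = trans (𝔼-cong arrivals λ ω →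
      reflexive (≡.cong (if_then meanIncrement j (gain k ω rest) (suc r) else 0#) (∧-zeroʳ (lookup ω j)))) (𝔼-0 arrivals)
    ... | yes at-t | yes at-k = trans (𝔼-cong arrivals λ ω → trans
      (reflexive (≡.cong (if_then meanIncrement j (gain k ω rest) (suc r) else 0#) (∧-identityʳ (lookup ω j))))
      (sym (𝟙*x≈if (lookup ω j) _)))
      (𝔼-arrival*meanIncrement r j at-t at-k)

    -- Write each maximum in `stage` as `W (suc r)` plus the surplus over it. The baseline parts
    -- then have weights `a` and `1# - a`, which recombine.
    stage-surplus : ∀ r → W (suc r) + ∑[ j ∈ T t ∩ S k ] surplus r j ≈ stage k t W (suc r)
    stage-surplus r = sym (begin
      ∑[ j ∈ T t ∩ S k ] ∑[ i < m ] (x i j * M i j) + (1# - a) * W′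
        ≈⟨ +-congʳ (sumOver-cong (T t ∩ S k) split) ⟩
      ∑[ j ∈ T t ∩ S k ] ((∑[ i < m ] x i j) * W′ + surplus r j) + (1# - a) * W′
        ≈⟨ +-congʳ (trans (sumOver-distrib-+ (T t ∩ S k) _ _) (+-congʳ (sumOver-distribʳ-* (T t ∩ S k) _ W′))) ⟩
      a * W′ + D + (1# - a) * W′
        ≈⟨ +-comm _ _ ⟩
      (1# - a) * W′ + (a * W′ + D)
        ≈⟨ +-assoc _ _ _ ⟨
      (1# - a) * W′ + a * W′ + D
        ≈⟨ +-congʳ ([1-a]x+ax≈x a W′) ⟩
      W′ + D ∎)
      where
      open ≈-Reasoning
      W′ = W (suc r)
      M : Fin m → Fin n → Carrier
      M i j = max (bid i j + W r) W′
      a = ∑[ j ∈ T t ∩ S k ] ∑[ i < m ] x i j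
      D = ∑[ j ∈ T t ∩ S k ] surplus r j
      split : ∀ j → ∑[ i < m ] (x i j * M i j) ≈ (∑[ i < m ] x i j) * W′ + surplus r j
      split j = begin
        ∑[ i < m ] (x i j * M i j)                               ≈⟨ sum-cong-≋ {m} (λ i → *-congˡ (x+[y-x]≈y W′ (M i j))) ⟨
        ∑[ i < m ] (x i j * (W′ + (M i j - W′)))                 ≈⟨ sum-cong-≋ {m} (λ i → distribˡ _ _ _) ⟩
        ∑[ i < m ] (x i j * W′ + x i j * (M i j - W′))           ≈⟨ ∑-distrib-+ {m} _ _ ⟩
        ∑[ i < m ] (x i j * W′) + surplus r j                    ≈⟨ +-congʳ (*-distribʳ-sum {m} W′ (λ i → x i j)) ⟨
        (∑[ i < m ] x i j) * W′ + surplus r j                    ∎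

    𝔼-gain-block : ∀ r → 𝔼 arrivals (λ ω → gain k ω (block t ++ rest) r) ≈ stage k t W r
    𝔼-gain-block zero    = trans (𝔼-cong arrivals (λ ω → gain-0 k ω (block t ++ rest))) (𝔼-0 arrivals)
    𝔼-gain-block (suc r) = begin
      𝔼 arrivals (λ ω → gain k ω (block t ++ rest) (suc r))
        -- `gain-block` holds for exclusive outcomes only, and these carry all the weight.
        ≈⟨ 𝔼-cong-exclusive (λ ω excl → trans
             (gain-block k excl t rest (suc r) (Uniqueₚ.filter⁺ _ (Uniqueₚ.allFin⁺ n)) (block-arrival t))
             (+-congˡ (listSum-filter (λ j → arrival j ≟ t) _ id))) ⟩
      𝔼 arrivals (λ ω → gain k ω rest (suc r)
        + ∑[ j < n ] (if does (arrival j ≟ t) then contribution k ω (gain k ω rest) (suc r) j else 0#))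
        ≈⟨ trans (𝔼-+ arrivals _ _) (+-congˡ (𝔼-∑ arrivals
             (λ j ω → if does (arrival j ≟ t) then contribution k ω (gain k ω rest) (suc r) j else 0#))) ⟩
      𝔼 arrivals (λ ω → gain k ω rest (suc r))
        + ∑[ j < n ] 𝔼 arrivals (λ ω → if does (arrival j ≟ t) then contribution k ω (gain k ω rest) (suc r) j else 0#)
        ≈⟨ +-cong (𝔼-rest (suc r)) (sum-cong-≋ {n} (𝔼-contribution r)) ⟩
      W (suc r) + ∑[ j ∈ T t ∩ S k ] surplus r j
        ≈⟨ stage-surplus r ⟩
      stage k t W (suc r) ∎
      where open ≈-Reasoning

  concatMap-block-≢ : ∀ t {v} (g : Fin v → Fin u) → (∀ t′ → t ≢ g t′) →
                      All (λ j → arrival j ≢ t) (concatMap block (tabulate g))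
  concatMap-block-≢ t {zero}  g t≢g = []
  concatMap-block-≢ t {suc v} g t≢g = Allₚ.++⁺
    (All.map (λ at-g eq → t≢g zero (≡.trans (≡.sym eq) at-g)) (block-arrival (g zero)))
    (concatMap-block-≢ t (g ∘ suc) (t≢g ∘ suc))

  -- The embedding `g` names the stages still to come, so the induction on `v` can drop the first
  -- one. Injectivity keeps later blocks apart from the current one, and the condition on `E`
  -- identifies the values used by `accepts` with those of the shortened recursion.
  𝔼-gain : ∀ k {v} (g : Fin v → Fin u) → (∀ {t t′} → g t ≡ g t′ → t ≡ t′) →
    (∀ t → E k (suc (g t)) ≡ backward v (stage k ∘ g) (const 0#) (suc t)) →
    ∀ r → 𝔼 arrivals (λ ω → gain k ω (concatMap block (tabulate g)) r) ≈ backward v (stage k ∘ g) (const 0#) zero r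
  𝔼-gain k {zero}  g g-inj E≡ r = 𝔼-0 arrivals
  𝔼-gain k {suc v} g g-inj E≡ r rewrite ≡.sym (E≡ zero) = 𝔼-gain-block k (g zero)
    (concatMap-block-≢ (g zero) (g ∘ suc) (λ t eq → 0≢1+n (g-inj eq)))
    (λ r → trans (𝔼-gain k (g ∘ suc) (suc-injective ∘ g-inj) (E≡ ∘ suc) r)
                 (reflexive (≡.cong (λ V → V r) (≡.sym (E≡ zero)))))
    r

  order-unique : Unique order
  order-unique = Uniqueₚ.concat⁺
    (Allₚ.map⁺ (All.universal (λ t → Uniqueₚ.filter⁺ _ (Uniqueₚ.allFin⁺ n)) (allFin u)))
    (AllPairsₚ.map⁺ (AllPairs.map disjoint (Uniqueₚ.allFin⁺ u)))
    where
    disjoint : ∀ {t t′} → t ≢ t′ → Disjoint (block t) (block t′)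
    disjoint t≢t′ (j∈t , j∈t′) =
      t≢t′ (≡.trans (≡.sym (All.lookup (block-arrival _) j∈t)) (All.lookup (block-arrival _) j∈t′))

  expectedRevenue≈E : expectedRevenue ≈ ∑[ k < s ] E k zero (capacity k)
  expectedRevenue≈E = begin
    expectedRevenue
      ≈⟨ 𝔼->>= arrivals (λ ω → run ω order ∅) revenue ⟩
    𝔼 arrivals (λ ω → 𝔼 (run ω order ∅) revenue)
      ≈⟨ 𝔼-cong arrivals (λ ω → trans (𝔼-cong (run ω order ∅) revenue-by-customer) (𝔼-∑ (run ω order ∅) revenueFrom)) ⟩
    𝔼 arrivals (λ ω → ∑[ k < s ] 𝔼 (run ω order ∅) (revenueFrom k))
      ≈⟨ 𝔼-cong arrivals (λ ω → sum-cong-≋ {s} λ k → run≈gain ω k) ⟩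
    𝔼 arrivals (λ ω → ∑[ k < s ] gain k ω order (capacity k))
      ≈⟨ 𝔼-∑ arrivals (λ k ω → gain k ω order (capacity k)) ⟩
    ∑[ k < s ] 𝔼 arrivals (λ ω → gain k ω order (capacity k))
      ≈⟨ sum-cong-≋ {s} (λ k → 𝔼-gain k id id (λ t → ≡.refl) (capacity k)) ⟩
    ∑[ k < s ] E k zero (capacity k) ∎
    where
    open ≈-Reasoning
    ∅ : Allocation
    ∅ i j = false
    used-∅ : ∀ k → used ∅ k ≡ 0
    used-∅ k = ≡.trans (ℕΣ.sum-cong-≋ {n} (λ j → no-use (lookup (S k) j))) (ℕΣ.sum-replicate-zero n)
      where
      module ℕΣ = CommutativeMonoidSum ℕₚ.+-0-commutativeMonoid
      no-use : ∀ b → (if b then sumℕ {m} (λ i → 0) else 0) ≡ 0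
      no-use true  = ℕΣ.sum-replicate-zero m
      no-use false = ≡.refl
    run≈gain : ∀ ω k → 𝔼 (run ω order ∅) (revenueFrom k) ≈ gain k ω order (capacity k)
    run≈gain ω k = begin
      𝔼 (run ω order ∅) (revenueFrom k)
        ≈⟨ 𝔼-run k ω order ∅ order-unique (All.universal (λ j i → ≡.refl) order) ⟩
      revenueFrom k ∅ + gain k ω order (capacity k ∸ used ∅ k)
        ≈⟨ +-cong (sum-zero {m} λ i → sum-replicate-zero n)
                  (reflexive (≡.cong (λ z → gain k ω order (capacity k ∸ z)) (used-∅ k))) ⟩
      0# + gain k ω order (capacity k)
        ≈⟨ +-identityˡ _ ⟩
      gain k ω order (capacity k) ∎

-- The dynamic program earns half of the linear-programming objective.

module LowerBound {c ℓ₁ ℓ₂} {F : OrderedField c ℓ₁ ℓ₂} {m n s u} (P : AdCell F m n s u)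
                  (x : Fin m → Fin n → OrderedField.Carrier F) (feasible : LinearProgram.IsFeasible P x) where
  open OrderedFieldProperties F
  open Arrivals P
  open AlgorithmB P x
  open LinearProgram P
  open IsFeasible feasible

  optimum : Fin s → Carrier
  optimum k = ∑[ j ∈ S k ] ∑[ i < m ] (x i j * bid i j)

  objective-by-customer : objective x ≈ ∑[ k < s ] optimum k
  objective-by-customer = sym (begin
    ∑[ k < s ] ∑[ j ∈ S k ] ∑[ i < m ] (x i j * bid i j)
      ≈⟨ sum-cong-≋ {s} (λ k → sum-cong-≋ {n} λ j → reflexive
           (≡.cong (if_then ∑[ i < m ] (x i j * bid i j) else 0#) (lookup∘tabulate (λ j → does (customer j ≟ k)) j))) ⟩
    ∑[ k < s ] ∑[ j < n ] (if does (customer j ≟ k) then ∑[ i < m ] (x i j * bid i j) else 0#)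
      ≈⟨ ∑-fibres customer _ ⟩
    ∑[ j < n ] ∑[ i < m ] (x i j * bid i j)
      ≈⟨ ∑-comm {m} {n} (λ i j → x i j * bid i j) ⟨
    objective x ∎)
    where open ≈-Reasoning

  -- Makes the coefficient `1# - a` in `stage` nonnegative, so that lower bounds on the later stage
  -- carry over.
  stage-mass≤1 : ∀ k t → ∑[ j ∈ T t ∩ S k ] ∑[ i < m ] x i j ≤ 1#
  stage-mass≤1 k t = ≤-trans (sumOver-mono-≤ (T t ∩ S k) query≤) (block-mass≤1 t k)

  module Threshold (k : Fin s) (τ : Carrier) (0≤τ : 0# ≤ τ) where

    excess : Fin m → Fin n → Carrier
    excess i j = max (bid i j - τ) 0#

    stageExcess : Fin u → Carrier
    stageExcess t = ∑[ j ∈ T t ∩ S k ] ∑[ i < m ] (x i j * excess i j)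

    0≤stageExcess : ∀ t → 0# ≤ stageExcess t
    0≤stageExcess t = sumOver-nonNeg (T t ∩ S k) λ j → sum-nonNeg λ i → *-nonNeg (x≥0 i j) (y≤max _ _)

    -- One unit of capacity is worth at most τ to the bound min (r · τ) w, so selling at a bid
    -- above τ improves the bound by the excess.
    best-choice : ∀ (V : ℕ → Carrier) w → (∀ r → min (r · τ) w ≤ V r) → ∀ r i j →
                  min (suc r · τ) w + excess i j ≤ max (bid i j + V r) (V (suc r))
    best-choice V w bound r i j with total (bid i j - τ) 0#
    ... | inj₁ small = begin
      min (suc r · τ) w + excess i j       ≈⟨ +-congˡ (x≤y⇒max≈y small) ⟩
      min (suc r · τ) w + 0#               ≈⟨ +-identityʳ _ ⟩
      min (suc r · τ) w                    ≤⟨ bound (suc r) ⟩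
      V (suc r)                            ≤⟨ y≤max _ _ ⟩
      max (bid i j + V r) (V (suc r))      ∎
      where open ≤-Reasoning
    ... | inj₂ large = begin
      min (suc r · τ) w + excess i j                ≈⟨ +-congˡ (y≤x⇒max≈x large) ⟩
      min (suc r · τ) w + (bid i j - τ)             ≤⟨ +-mono-≤ one-unit ≤-refl ⟩
      (τ + min (r · τ) w) + (bid i j - τ)           ≈⟨ +-congʳ (+-comm _ _) ⟩
      (min (r · τ) w + τ) + (bid i j - τ)           ≈⟨ +-assoc _ _ _ ⟩
      min (r · τ) w + (τ + (bid i j - τ))           ≈⟨ +-congˡ (x+[y-x]≈y τ (bid i j)) ⟩
      min (r · τ) w + bid i j                       ≈⟨ +-comm _ _ ⟩
      bid i j + min (r · τ) w                       ≤⟨ +-mono-≤ ≤-refl (bound r) ⟩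
      bid i j + V r                                 ≤⟨ x≤max _ _ ⟩
      max (bid i j + V r) (V (suc r))               ∎
      where
      open ≤-Reasoning
      one-unit : min (suc r · τ) w ≤ τ + min (r · τ) w
      one-unit with min-sel (r · τ) w
      ... | inj₁ eq = ≤-trans (min≤x _ _) (≤-reflexive (+-congˡ (sym eq)))
      ... | inj₂ eq = ≤-trans (min≤y _ _) (≤-trans (≤-reflexive (sym (+-identityˡ w))) (+-mono-≤ 0≤τ (≤-reflexive (sym eq))))

    -- Let `L` be the bound for the later stage. Selling `j` to `i` or keeping the capacity,
    -- whichever is better, yields `L` plus the excess, and choosing nobody yields `L`; averaging
    -- gives `L` plus `stageExcess t`. This dominates the new minimum because the excess is
    -- nonnegative.
    stage-bound : ∀ t V w → (∀ r → min (r · τ) w ≤ V r) → ∀ r → min (r · τ) (stageExcess t + w) ≤ stage k t V r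
    -- Both `0 · τ` and the value at capacity zero compute to `0#`.
    stage-bound t V w bound zero    = min≤x _ _
    stage-bound t V w bound (suc r) = begin
      min (suc r · τ) (stageExcess t + w)
        ≤⟨ absorb ⟩
      stageExcess t + L
        ≈⟨ +-congˡ (trans (+-comm _ _) ([1-a]x+ax≈x a L)) ⟨
      stageExcess t + (a * L + (1# - a) * L)
        ≈⟨ +-assoc _ _ _ ⟨
      stageExcess t + a * L + (1# - a) * L
        ≈⟨ +-congʳ (trans (+-comm _ _) (trans (+-congʳ (sym (sumOver-distribʳ-* (T t ∩ S k) _ L)))
             (sym (sumOver-distrib-+ (T t ∩ S k) _ _)))) ⟩
      ∑[ j ∈ T t ∩ S k ] ((∑[ i < m ] x i j) * L + ∑[ i < m ] (x i j * excess i j)) + (1# - a) * L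
        ≤⟨ +-mono-≤ (sumOver-mono-≤ (T t ∩ S k) per-query) (*-monoˡ-≤ (x≤y⇒0≤y-x (stage-mass≤1 k t)) (bound (suc r))) ⟩
      stage k t V (suc r) ∎
      where
      open ≤-Reasoning
      a = ∑[ j ∈ T t ∩ S k ] ∑[ i < m ] x i j
      L = min (suc r · τ) w
      absorb : min (suc r · τ) (stageExcess t + w) ≤ stageExcess t + L
      absorb with min-sel (suc r · τ) w
      ... | inj₁ eq = ≤-trans (min≤x _ _) (≤-trans (≤-reflexive (sym (+-identityˡ _)))
        (+-mono-≤ (0≤stageExcess t) (≤-reflexive (sym eq))))
      ... | inj₂ eq = ≤-trans (min≤y _ _) (≤-reflexive (+-congˡ (sym eq)))
      per-query : ∀ j → (∑[ i < m ] x i j) * L + ∑[ i < m ] (x i j * excess i j) ≤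
                        ∑[ i < m ] (x i j * max (bid i j + V r) (V (suc r)))
      per-query j = begin
        (∑[ i < m ] x i j) * L + ∑[ i < m ] (x i j * excess i j)    ≈⟨ +-congʳ (*-distribʳ-sum {m} L (λ i → x i j)) ⟩
        ∑[ i < m ] (x i j * L) + ∑[ i < m ] (x i j * excess i j)    ≈⟨ ∑-distrib-+ {m} _ _ ⟨
        ∑[ i < m ] (x i j * L + x i j * excess i j)                 ≈⟨ sum-cong-≋ {m} (λ i → distribˡ _ _ _) ⟨
        ∑[ i < m ] (x i j * (L + excess i j))                       ≤⟨ sum-mono-≤ {m} (λ i → *-monoˡ-≤ (x≥0 i j) (best-choice V w bound r i j)) ⟩
        ∑[ i < m ] (x i j * max (bid i j + V r) (V (suc r)))        ∎

    -- As in `𝔼-gain`, `g` indexes the remaining stages; after the last one the sum of excesses is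
    -- empty.
    backward-bound : ∀ {v} (g : Fin v → Fin u) r →
                     min (r · τ) (∑[ t < v ] stageExcess (g t)) ≤ backward v (stage k ∘ g) (const 0#) zero r
    backward-bound {zero}  g r = min≤y _ _
    backward-bound {suc v} g r = stage-bound (g zero) _ _ (backward-bound (g ∘ suc)) r

    totalExcess : Carrier
    totalExcess = ∑[ j ∈ S k ] ∑[ i < m ] (x i j * excess i j)

    totalExcess-by-stage : ∑[ t < u ] stageExcess t ≈ totalExcess
    totalExcess-by-stage = trans (sum-cong-≋ {u} λ t → sum-cong-≋ {n} (split t)) (∑-fibres arrival _)
      where
      split : ∀ t j → (if lookup (T t ∩ S k) j then ∑[ i < m ] (x i j * excess i j) else 0#) ≈
                      (if does (arrival j ≟ t) then (if lookup (S k) j then ∑[ i < m ] (x i j * excess i j) else 0#) else 0#)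
      split t j rewrite lookup-T∩S t k j | lookup∘tabulate (λ j → does (customer j ≟ k)) j with does (arrival j ≟ t)
      ... | true  = refl
      ... | false = refl

    E-bound : ∀ {z} r → z ≤ r · τ → z ≤ totalExcess → z ≤ E k zero r
    E-bound r z≤rτ z≤excess = ≤-trans
      (min-glb z≤rτ (≤-trans z≤excess (≤-reflexive (sym totalExcess-by-stage))))
      (backward-bound id r)

    bid≤excess+τ : ∀ i j → bid i j ≤ excess i j + τ
    bid≤excess+τ i j = begin
      bid i j                ≈⟨ x+[y-x]≈y τ (bid i j) ⟨
      τ + (bid i j - τ)      ≈⟨ +-comm _ _ ⟩
      (bid i j - τ) + τ      ≤⟨ +-monoˡ-≤ τ (x≤max _ _) ⟩
      excess i j + τ         ∎
      where open ≤-Reasoning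

    -- Weak duality with price `τ` on the capacity and `b` covering the rest of each bid: the
    -- customer constraint limits the total payment of the price. The general `b` allows `excess` as
    -- well as the zero function.
    optimum-bound : ∀ (b : Fin m → Fin n → Carrier) → (∀ i j → bid i j ≤ b i j + τ) →
                    optimum k ≤ ∑[ j ∈ S k ] ∑[ i < m ] (x i j * b i j) + capacity k · τ
    optimum-bound b bid≤ = begin
      optimum k
        ≤⟨ sumOver-mono-≤ (S k) per-query ⟩
      ∑[ j ∈ S k ] (∑[ i < m ] (x i j * b i j) + (∑[ i < m ] x i j) * τ)
        ≈⟨ trans (sumOver-distrib-+ (S k) _ _) (+-congˡ (sumOver-distribʳ-* (S k) _ τ)) ⟩
      ∑[ j ∈ S k ] ∑[ i < m ] (x i j * b i j) + (∑[ j ∈ S k ] ∑[ i < m ] x i j) * τ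
        ≈⟨ +-congˡ (*-comm _ τ) ⟩
      ∑[ j ∈ S k ] ∑[ i < m ] (x i j * b i j) + τ * ∑[ j ∈ S k ] ∑[ i < m ] x i j
        ≤⟨ +-mono-≤ ≤-refl (*-monoˡ-≤ 0≤τ (customer≤ k)) ⟩
      ∑[ j ∈ S k ] ∑[ i < m ] (x i j * b i j) + τ * (capacity k · 1#)
        ≈⟨ +-congˡ (trans (×-comm-* (capacity k) τ 1#) (×-congʳ (capacity k) (*-identityʳ τ))) ⟩
      ∑[ j ∈ S k ] ∑[ i < m ] (x i j * b i j) + capacity k · τ ∎
      where
      open ≤-Reasoning
      per-query : ∀ j → ∑[ i < m ] (x i j * bid i j) ≤ ∑[ i < m ] (x i j * b i j) + (∑[ i < m ] x i j) * τ
      per-query j = begin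
        ∑[ i < m ] (x i j * bid i j)                              ≤⟨ sum-mono-≤ {m} (λ i → *-monoˡ-≤ (x≥0 i j) (bid≤ i j)) ⟩
        ∑[ i < m ] (x i j * (b i j + τ))                          ≈⟨ sum-cong-≋ {m} (λ i → distribˡ _ _ _) ⟩
        ∑[ i < m ] (x i j * b i j + x i j * τ)                    ≈⟨ ∑-distrib-+ {m} _ _ ⟩
        ∑[ i < m ] (x i j * b i j) + ∑[ i < m ] (x i j * τ)       ≈⟨ +-congˡ (*-distribʳ-sum {m} τ (λ i → x i j)) ⟨
        ∑[ i < m ] (x i j * b i j) + (∑[ i < m ] x i j) * τ       ∎

    0≤totalExcess : 0# ≤ totalExcess
    0≤totalExcess = ≤-trans (sum-nonNeg 0≤stageExcess) (≤-reflexive totalExcess-by-stage)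

  0≤optimum : ∀ k → 0# ≤ optimum k
  0≤optimum k = sumOver-nonNeg (S k) λ j → sum-nonNeg {m} λ i → *-nonNeg (x≥0 i j) (bid≥0 i j)

  ½optimum≤E : ∀ k → ½ * optimum k ≤ E k zero (capacity k)
  ½optimum≤E k with capacity k in cap
  -- The price in the other case divides by the capacity. At capacity zero the linear program itself
  -- earns nothing from this customer.
  ... | zero = Threshold.E-bound k β 0≤β 0 ½O≤0 (≤-trans ½O≤0 (Threshold.0≤totalExcess k β 0≤β))
    where
    -- A price no smaller than any bid, so that `optimum-bound` applies with `b` zero, and the term
    -- `capacity k · β` vanishes.
    β : Carrier
    β = ∑[ i < m ] ∑[ j < n ] bid i j
    0≤β : 0# ≤ β
    0≤β = sum-nonNeg {m} λ i → sum-nonNeg {n} λ j → bid≥0 i j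
    bid≤β : ∀ i j → bid i j ≤ 0# + β
    bid≤β i j = begin
      bid i j                ≤⟨ term≤sum (bid i) (bid≥0 i) j ⟩
      ∑[ j < n ] bid i j     ≤⟨ term≤sum _ (λ i → sum-nonNeg {n} (bid≥0 i)) i ⟩
      β                      ≈⟨ +-identityˡ β ⟨
      0# + β                 ∎
      where open ≤-Reasoning
    ½O≤0 : ½ * optimum k ≤ 0#
    ½O≤0 = begin
      ½ * optimum k          ≤⟨ *-monoˡ-≤ 0≤½ (Threshold.optimum-bound k β 0≤β (λ _ _ → 0#) bid≤β) ⟩
      ½ * (∑[ j ∈ S k ] ∑[ i < m ] (x i j * 0#) + capacity k · β)
        ≈⟨ *-congˡ (+-cong (sumOver-zero (S k) λ j → sum-zero {m} λ i → zeroʳ _) (reflexive (≡.cong (_· β) cap))) ⟩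
      ½ * (0# + 0#)          ≈⟨ trans (*-congˡ (+-identityˡ 0#)) (zeroʳ ½) ⟩
      0#                     ∎
      where
      open ≤-Reasoning
  ... | suc r = E-bound (suc r) (≤-reflexive (sym cτ≈½O)) ½O≤excess
    where
    C = suc r · 1#
    C*C⁻¹≈1 : C * C ⁻¹ ≈ 1#
    C*C⁻¹≈1 = ⁻¹-inverseʳ (1≤x⇒x≉0 (1≤suc·1 r))
    ½O = ½ * optimum k
    0≤½O : 0# ≤ ½O
    0≤½O = *-nonNeg 0≤½ (0≤optimum k)
    -- Chosen so that selling the whole capacity at price `τ` earns exactly half of the optimum.
    τ = ½O / C
    0≤τ : 0# ≤ τ
    0≤τ = *-nonNeg 0≤½O (x*y≈1⇒0≤y (≤-trans 0≤1 (1≤suc·1 r)) C*C⁻¹≈1)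
    open Threshold k τ 0≤τ
    cτ≈½O : suc r · τ ≈ ½O
    cτ≈½O = begin
      suc r · τ             ≈⟨ ×-congʳ (suc r) (*-identityʳ τ) ⟨
      suc r · (τ * 1#)      ≈⟨ ×-comm-* (suc r) τ 1# ⟨
      ½O * C ⁻¹ * C         ≈⟨ *-assoc _ _ _ ⟩
      ½O * (C ⁻¹ * C)       ≈⟨ *-congˡ (trans (*-comm _ _) C*C⁻¹≈1) ⟩
      ½O * 1#               ≈⟨ *-identityʳ ½O ⟩
      ½O                    ∎
      where open ≈-Reasoning
    ½O≤excess : ½O ≤ totalExcess
    -- The price accounts for one half of the optimum, so the excess must account for the other.
    ½O≤excess = +-cancelʳ-≤ ½O (begin
      ½O + ½O                          ≈⟨ ½x+½x≈x (optimum k) ⟩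
      optimum k                        ≤⟨ optimum-bound excess bid≤excess+τ ⟩
      totalExcess + capacity k · τ     ≈⟨ +-congˡ (trans (reflexive (≡.cong (_· τ) cap)) cτ≈½O) ⟩
      totalExcess + ½O                 ∎)
      where open ≤-Reasoning

  ½objective≤∑E : ½ * objective x ≤ ∑[ k < s ] E k zero (capacity k)
  ½objective≤∑E = begin
    ½ * objective x                     ≈⟨ *-congˡ objective-by-customer ⟩
    ½ * ∑[ k < s ] optimum k            ≈⟨ *-distribˡ-sum {s} ½ optimum ⟩
    ∑[ k < s ] (½ * optimum k)          ≤⟨ sum-mono-≤ {s} ½optimum≤E ⟩
    ∑[ k < s ] E k zero (capacity k)    ∎
    where open ≤-Reasoning

-- The offline optimum is bounded by the linear program.

module OfflineBound {c ℓ₁ ℓ₂} {F : OrderedField c ℓ₁ ℓ₂} {m n s u} (P : AdCell F m n s u)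
                    (opt : Subset n → Allocations.Allocation P)
                    (isAllocation : ∀ ω → Allocations.IsAllocation P ω (opt ω)) where
  open OrderedFieldProperties F
  open Expectation F
  open AdCell P
  open LinearProgram P
  open Allocations P

  allocationProbability : Fin m → Fin n → Carrier
  allocationProbability i j = 𝔼 arrivals (λ ω → 𝟙 (opt ω i j))

  𝟙≈toℕ·1 : ∀ b → 𝟙 b ≈ toℕ b · 1#
  𝟙≈toℕ·1 true  = sym (+-identityʳ 1#)
  𝟙≈toℕ·1 false = refl

  ∑𝟙≈count : ∀ ω j → ∑[ i < m ] 𝟙 (opt ω i j) ≈ sumℕ (λ i → toℕ (opt ω i j)) · 1#
  ∑𝟙≈count ω j = trans (sum-cong-≋ {m} λ i → 𝟙≈toℕ·1 (opt ω i j)) (sym (sumℕ-homo (λ i → toℕ (opt ω i j)) 1#))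

  -- Each constraint holds outcome by outcome for the indicators of the allocation, and taking
  -- expectations preserves it; `marginal` turns the arrival indicator into `p j`.
  allocationProbability-feasible : IsFeasible allocationProbability
  allocationProbability-feasible = record
    { query≤ = λ j → begin
        ∑[ i < m ] allocationProbability i j                  ≈⟨ 𝔼-∑ arrivals (λ i ω → 𝟙 (opt ω i j)) ⟨
        𝔼 arrivals (λ ω → ∑[ i < m ] 𝟙 (opt ω i j))           ≤⟨ 𝔼-mono-≤ isProbability (λ ω → query≤ω ω j) ⟩
        𝔼 arrivals (λ ω → 𝟙 (lookup ω j))                     ≈⟨ marginal j ⟩
        p j                                                   ∎
    ; customer≤ = λ k → begin
        ∑[ j ∈ S k ] ∑[ i < m ] allocationProbability i j
          ≈⟨ sumOver-cong (S k) (λ j → 𝔼-∑ arrivals (λ i ω → 𝟙 (opt ω i j))) ⟨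
        ∑[ j ∈ S k ] 𝔼 arrivals (λ ω → ∑[ i < m ] 𝟙 (opt ω i j))
          ≈⟨ 𝔼-sumOver arrivals (S k) (λ j ω → ∑[ i < m ] 𝟙 (opt ω i j)) ⟨
        𝔼 arrivals (λ ω → ∑[ j ∈ S k ] ∑[ i < m ] 𝟙 (opt ω i j))
          ≤⟨ 𝔼-mono-≤ isProbability (λ ω → customer≤ω ω k) ⟩
        𝔼 arrivals (const (capacity k · 1#))
          ≈⟨ 𝔼-const isProbability _ ⟩
        capacity k · 1# ∎
    ; x≥0 = λ i j → 0≤𝔼 (IsProbability.nonNeg isProbability) (λ ω → 0≤𝟙 (opt ω i j))
    ; x≤1 = λ i j → ≤-trans (𝔼-mono-≤ isProbability (λ ω → 𝟙≤1 (opt ω i j))) (≤-reflexive (𝔼-const isProbability 1#))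
    }
    where
    open ≤-Reasoning
    𝟙≤1 : ∀ b → 𝟙 b ≤ 1#
    𝟙≤1 true  = ≤-refl
    𝟙≤1 false = 0≤1
    query≤ω : ∀ ω j → ∑[ i < m ] 𝟙 (opt ω i j) ≤ 𝟙 (lookup ω j)
    query≤ω ω j = begin
      ∑[ i < m ] 𝟙 (opt ω i j)                    ≈⟨ ∑𝟙≈count ω j ⟩
      sumℕ (λ i → toℕ (opt ω i j)) · 1#           ≤⟨ ·1-mono-≤ (IsAllocation.query≤ (isAllocation ω) j) ⟩
      toℕ (lookup ω j) · 1#                       ≈⟨ 𝟙≈toℕ·1 (lookup ω j) ⟨
      𝟙 (lookup ω j)                              ∎
    customer≤ω : ∀ ω k → ∑[ j ∈ S k ] ∑[ i < m ] 𝟙 (opt ω i j) ≤ capacity k · 1#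
    customer≤ω ω k = begin
      ∑[ j ∈ S k ] ∑[ i < m ] 𝟙 (opt ω i j)       ≈⟨ sum-cong-≋ {n} (λ j → count j (lookup (S k) j)) ⟩
      ∑[ j < n ] ((if lookup (S k) j then sumℕ (λ i → toℕ (opt ω i j)) else 0) · 1#)
                                                  ≈⟨ sumℕ-homo {n} _ 1# ⟨
      used (opt ω) k · 1#                         ≤⟨ ·1-mono-≤ (IsAllocation.customer≤ (isAllocation ω) k) ⟩
      capacity k · 1#                             ∎
      where
      count : ∀ j b → (if b then ∑[ i < m ] 𝟙 (opt ω i j) else 0#) ≈ (if b then sumℕ (λ i → toℕ (opt ω i j)) else 0) · 1#
      count j true  = ∑𝟙≈count ω j
      count j false = refl

  expectedOfflineRevenue≈objective : expectedOfflineRevenue opt ≈ objective allocationProbability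
  expectedOfflineRevenue≈objective = begin
    𝔼 arrivals (λ ω → ∑[ i < m ] ∑[ j < n ] (if opt ω i j then bid i j else 0#))
      ≈⟨ 𝔼-cong arrivals (λ ω → sum-cong-≋ {m} λ i → sum-cong-≋ {n} λ j → sym (𝟙*x≈if (opt ω i j) (bid i j))) ⟩
    𝔼 arrivals (λ ω → ∑[ i < m ] ∑[ j < n ] (𝟙 (opt ω i j) * bid i j))
      ≈⟨ 𝔼-∑ arrivals (λ i ω → ∑[ j < n ] (𝟙 (opt ω i j) * bid i j)) ⟩
    ∑[ i < m ] 𝔼 arrivals (λ ω → ∑[ j < n ] (𝟙 (opt ω i j) * bid i j))
      ≈⟨ sum-cong-≋ {m} (λ i → 𝔼-∑ arrivals (λ j ω → 𝟙 (opt ω i j) * bid i j)) ⟩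
    ∑[ i < m ] ∑[ j < n ] 𝔼 arrivals (λ ω → 𝟙 (opt ω i j) * bid i j)
      ≈⟨ sum-cong-≋ {m} (λ i → sum-cong-≋ {n} λ j → 𝔼-*ʳ arrivals (bid i j) (λ ω → 𝟙 (opt ω i j))) ⟩
    objective allocationProbability ∎
    where open ≈-Reasoning

-- Both comparisons.

theorem3 : ∀ {c ℓ₁ ℓ₂ : Level} (F : OrderedField c ℓ₁ ℓ₂) {m n s u : ℕ} (P : AdCell F m n s u) →
    let open OrderedField F
        open LinearProgram P
        open Allocations P
        open AlgorithmB P using (expectedRevenue)
    in ∀ (x* : Fin m → Fin n → Carrier) → IsOptimalSolution x* →
       (∀ (OPT : Carrier) → IsOptimalValue OPT → ½ * OPT ≤ expectedRevenue x*)
       × (∀ (opt : Subset n → Allocation) → IsOptimalOffline opt →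
            ½ * expectedOfflineRevenue opt ≤ expectedRevenue x*)
theorem3 F P x* (feasible , optimal) =
  -- The value may be witnessed by an optimal solution `y` other than `x*`; the optimality of `x*`
  -- covers it.
  (λ { OPT (y , (y-feasible , _) , OPT≈) → ½*≤ (≤-trans (≤-reflexive OPT≈) (optimal y y-feasible)) }) ,
  (λ opt isOptimal → let open OfflineBound P opt (proj₁ ∘ isOptimal) in
    ½*≤ (≤-trans (≤-reflexive expectedOfflineRevenue≈objective) (optimal _ allocationProbability-feasible)))
  where
  open OrderedFieldProperties F
  open LinearProgram P
  open AlgorithmB P x* using (expectedRevenue)
  ½*≤ : ∀ {z} → z ≤ objective x* → ½ * z ≤ expectedRevenue
  ½*≤ z≤ = ≤-trans (*-monoˡ-≤ 0≤½ z≤) (≤-trans (LowerBound.½objective≤∑E P x* feasible)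
    (≤-reflexive (sym (ExpectedRevenue.expectedRevenue≈E P x*))))
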